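{- The problem Strong Rainbow Vertex Connectivity is solvable in polynomial time when restricted to instances whose input graph is a block graph.
   Context: All graphs are simple, undirected and finite. A vertex-coloring of $G=(V,E)$ is an arbitrary map $\psi: V \to C$ to a set of colors $C$ (adjacent vertices may share a color). A path in a vertex-colored graph is vertex rainbow if its internal vertices have pairwise distinct colors. $G$ is strongly rainbow vertex connected under $\psi$ if between every pair of its vertices there is a shortest path (a path of length equal to their distance in $G$) that is vertex rainbow. Strong Rainbow Vertex Connectivity: the input is a connected undirected graph $G=(V,E)$ and a vertex-coloring $\psi: V\to C$; the question is whether $G$ is strongly rainbow vertex connected under $\psi$. A cut vertex is a vertex whose removal disconnects the graph. A biconnected graph is a connected graph with no cut vertices. A block graph is a graph in which every maximal biconnected component (block) is a clique. -}

module Defs where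

open import Data.Bool using (Bool; true; false; T; if_then_else_)
open import Data.Fin using (Fin)
open import Data.Fin.Subset using (Subset; _∈_; _⊆_; _-_; ⊤)
open import Data.List using (List; []; _∷_; _++_; length; map; concatMap; allFin; head; drop)
open import Data.List.Relation.Unary.All using (All)
open import Data.List.Relation.Unary.Unique.Propositional using (Unique)
open import Data.Maybe using (Maybe; just; nothing; fromMaybe)
open import Data.Nat using (ℕ; zero; suc; _+_; _*_; _∸_; _^_; _≤_; _≡ᵇ_)
open import Data.Nat.Binary using (ℕᵇ; 2[1+_]; 1+[2_]; fromℕ) renaming (zero to zeroᵇ)
open import Data.Product using (Σ-syntax; ∃-syntax; _×_)
open import Function using (_∘_)
open import Relation.Binary.Construct.Closure.ReflexiveTransitive using (Star; ε; _◅_)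
open import Relation.Binary.PropositionalEquality using (_≡_; _≢_)
open import Relation.Nullary using (¬_; Dec; does)

------------------------------------------------------------------------
-- Graphs and paths

record Graph (n : ℕ) : Set where
  field
    adj    : Fin n → Fin n → Bool
    irrefl : ∀ u → ¬ T (adj u u)
    sym    : ∀ u v → T (adj u v) → T (adj v u)

  Adj : Fin n → Fin n → Set
  Adj u v = T (adj u v)

open Graph public using (adj; Adj)

Walk : ∀ {n} → Graph n → Fin n → Fin n → Set
Walk G = Star (Adj G)

module _ {V : Set} {R : V → V → Set} where

  vertices : ∀ {u v} → Star R u v → List V
  vertices (ε {u})       = u ∷ []
  vertices (_◅_ {u} _ w) = u ∷ vertices w

  allButLast : ∀ {u v} → Star R u v → List V
  allButLast ε             = []
  allButLast (_◅_ {u} _ w) = u ∷ allButLast w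

  internal : ∀ {u v} → Star R u v → List V
  internal ε       = []
  internal (_ ◅ w) = allButLast w

  edges : ∀ {u v} → Star R u v → ℕ
  edges ε       = 0
  edges (_ ◅ w) = suc (edges w)

record Path {n : ℕ} (G : Graph n) (u v : Fin n) : Set where
  constructor path
  field
    walk   : Walk G u v
    simple : Unique (vertices walk)

open Path public

IsDistance : ∀ {n} (G : Graph n) → Fin n → Fin n → ℕ → Set
IsDistance G u v d = (Σ[ p ∈ Path G u v ] edges (walk p) ≡ d)
                   × (∀ (p : Path G u v) → d ≤ edges (walk p))

IsShortest : ∀ {n} {G : Graph n} {u v : Fin n} → Path G u v → Set
IsShortest {G = G} {u} {v} p = IsDistance G u v (edges (walk p))

------------------------------------------------------------------------
-- Block graphs

module _ {n : ℕ} (G : Graph n) where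

  -- A vertex set S stands for the subgraph of G induced by S.  Blocks are
  -- always induced: adding edges between vertices of a biconnected subgraph
  -- keeps it biconnected, so a maximal one already has all of them.

  ConnectedOn : Subset n → Set
  ConnectedOn S = ∀ u v → u ∈ S → v ∈ S →
    Σ[ p ∈ Path G u v ] All (_∈ S) (vertices (walk p))

  CutVertexOn : Subset n → Fin n → Set
  CutVertexOn S x = x ∈ S × ¬ ConnectedOn (S - x)

  BiconnectedOn : Subset n → Set
  BiconnectedOn S = ConnectedOn S × (∀ x → ¬ CutVertexOn S x)

  IsBlock : Subset n → Set
  IsBlock S = BiconnectedOn S × (∀ S′ → S ⊆ S′ → BiconnectedOn S′ → S′ ⊆ S)

  IsClique : Subset n → Set
  IsClique S = ∀ u v → u ∈ S → v ∈ S → u ≢ v → Adj G u v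

  IsBlockGraph : Set
  IsBlockGraph = ∀ S → IsBlock S → IsClique S

  Connected : Set
  Connected = ConnectedOn ⊤

------------------------------------------------------------------------
-- Strong rainbow vertex connectivity

VertexRainbow : ∀ {n} {C : Set} {G : Graph n} {u v : Fin n} →
                (Fin n → C) → Path G u v → Set
VertexRainbow ψ p = Unique (map ψ (internal (walk p)))

StronglyRainbowVertexConnected : ∀ {n} {C : Set} → Graph n → (Fin n → C) → Set
StronglyRainbowVertexConnected G ψ =
  ∀ u v → Σ[ p ∈ Path G u v ] IsShortest p × VertexRainbow ψ p

-- Only finitely many colours occur, so they are named by natural numbers.
record Instance : Set where
  field
    {order}   : ℕ
    graph     : Graph order
    colour    : Fin order → ℕ
    connected : Connected graph

-- A self-delimiting binary code: each bijective base-2 digit, least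
-- significant first, is preceded by true, and false ends the number.
encodeℕᵇ : ℕᵇ → List Bool
encodeℕᵇ zeroᵇ    = false ∷ []
encodeℕᵇ 2[1+ b ] = true ∷ true ∷ encodeℕᵇ b
encodeℕᵇ 1+[2 b ] = true ∷ false ∷ encodeℕᵇ b

encodeℕ : ℕ → List Bool
encodeℕ = encodeℕᵇ ∘ fromℕ

-- The order, the adjacency matrix row by row, and the colours.
encode : Instance → List Bool
encode I = encodeℕ order
        ++ concatMap (λ u → map (adj graph u) (allFin order)) (allFin order)
        ++ concatMap (encodeℕ ∘ colour) (allFin order)
  where open Instance I

------------------------------------------------------------------------
-- Polynomial time

-- The random access machine of Cook and Reckhow (1973), over ℕ with truncated
-- subtraction, reading an input tape of bits.  Every instruction costs one
-- step.  Without multiplication, t steps only produce numbers of O(t) bits,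
-- so polynomial time here is polynomial time on Turing machines.

data Instr : Set where
  const : (d c : ℕ) → Instr      -- X[d] := c
  add   : (d i j : ℕ) → Instr    -- X[d] := X[i] + X[j]
  sub   : (d i j : ℕ) → Instr    -- X[d] := X[i] ∸ X[j]
  load  : (d i : ℕ) → Instr      -- X[d] := X[X[i]]
  store : (i j : ℕ) → Instr      -- X[X[i]] := X[j]
  jump  : (i l : ℕ) → Instr      -- go to instruction l if X[i] > 0
  read  : (d : ℕ) → Instr        -- X[d] := next input bit (0 if none is left)
  halt  : (b : Bool) → Instr     -- stop with answer b

Program : Set
Program = List Instr

Memory : Set
Memory = ℕ → ℕ

_[_↦_] : Memory → ℕ → ℕ → Memory
(X [ a ↦ x ]) b = if b ≡ᵇ a then x else X b

-- Running off the end of the program counts as answering false.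
fetch : Program → ℕ → Instr
fetch P pc = fromMaybe (halt false) (head (drop pc P))

-- The answer given within t steps, if any, from program counter pc, memory X
-- and remaining input.
run : Program → (t pc : ℕ) → Memory → List Bool → Maybe Bool
run P zero    pc X input = nothing
run P (suc t) pc X input with fetch P pc
... | const d c = run P t (suc pc) (X [ d ↦ c ]) input
... | add d i j = run P t (suc pc) (X [ d ↦ X i + X j ]) input
... | sub d i j = run P t (suc pc) (X [ d ↦ X i ∸ X j ]) input
... | load d i  = run P t (suc pc) (X [ d ↦ X (X i) ]) input
... | store i j = run P t (suc pc) (X [ X i ↦ X j ]) input
... | jump i l  = run P t (if X i ≡ᵇ 0 then suc pc else l) X input
... | halt b    = just b
... | read d with input
...   | []       = run P t (suc pc) (X [ d ↦ 0 ]) []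
...   | b ∷ rest = run P t (suc pc) (X [ d ↦ (if b then 1 else 0) ]) rest

outcome : Program → List Bool → ℕ → Maybe Bool
outcome P input t = run P t 0 (λ _ → 0) input

-- The decision problem `Yes`, restricted to the instances satisfying `Allowed`:
-- nothing is required of the program on other inputs.
SolvableInPolynomialTime :
  {I : Set} (enc : I → List Bool) (Allowed Yes : I → Set) → Set
SolvableInPolynomialTime enc Allowed Yes =
  ∃[ P ] ∃[ c ] ∃[ k ] ∀ i → Allowed i →
    Σ[ answer ∈ Dec (Yes i) ]
      outcome P (enc i) (c * length (enc i) ^ k + c) ≡ just (does answer)

{-# OPTIONS --safe #-}

-- Call a vertex forked if it has two distinct non-adjacent neighbours.  The
-- internal vertices of a shortest path are forked, by the neighbours on the
-- path, so if distinct forked vertices have distinct colours, then every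
-- shortest path is rainbow.  Conversely, in a block graph two neighbours a, b
-- of x that are joined by a path avoiding x lie on a cycle through x, which is
-- biconnected and hence inside a clique.  A forked vertex x therefore separates
-- any vertex y from some neighbour u of x.  If y is forked too and v is a
-- neighbour of y separated from x by y, then every path from u to v has both
-- x and y as internal vertices, and x and y need distinct colours.  So it
-- suffices to search for two distinct forked vertices of the same colour, which
-- a random access machine does with four nested loops over the vertices.

module Submission where

open import Defs
open import Data.Bool using (Bool; true; false; T; if_then_else_)
open import Data.Bool.Properties using (T?; T-≡)
open import Data.Empty using (⊥; ⊥-elim)
open import Data.Fin as F using (Fin; zero; suc; toℕ; fromℕ<)
open import Data.Fin.Properties using (any?; toℕ<n; toℕ-fromℕ<; toℕ-injective)
open import Data.Fin.Subset using (Subset; _⊆_; _⊂_; _-_; _─_; ∣_∣; ⁅_⁆; inside; outside)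
  renaming (_∈_ to _∈ˢ_)
open import Data.Fin.Subset.Properties
  using (x∈p∧x≢y⇒x∈p-y; p⊂q⇒∣p∣<∣q∣; ∣p∣≤n; p─q⊆p; x∈⁅x⁆; ∈⊤)
  renaming (_∈?_ to _∈ˢ?_)
open import Data.List
  using (List; []; _∷_; _++_; length; map; replicate; concat; concatMap; allFin; tabulate)
open import Data.List.Membership.Propositional using (_∈_)
import Data.List.Membership.DecPropositional as DecMembership
open import Data.List.Membership.Propositional.Properties using (∈-map⁺)
open import Data.List.Properties using (length-map; length-++; length-tabulate; map-∘; ++-assoc)
open import Data.List.Relation.Unary.All as All using (All; []; _∷_)
import Data.List.Relation.Unary.All.Properties as All
open import Data.List.Relation.Unary.AllPairs using (AllPairs; []; _∷_)
import Data.List.Relation.Unary.AllPairs.Properties as AllPairs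
open import Data.List.Relation.Unary.Any using (here; there)
open import Data.List.Relation.Unary.Unique.Propositional using (Unique)
open import Data.Maybe using (just)
open import Data.Nat
open import Data.Nat.Binary using (2[1+_]; 1+[2_]; fromℕ) renaming (zero to zeroᵇ; toℕ to toℕᵇ)
open import Data.Nat.Binary.Properties using (toℕ-fromℕ)
open import Data.Nat.Properties
open import Data.Nat.Solver using (module +-*-Solver)
open import Data.Product using (Σ-syntax; ∃-syntax; _×_; _,_; proj₁; proj₂)
open import Data.Sum using (_⊎_; inj₁; inj₂)
open import Data.Vec as Vec using ([]; _∷_; here; there)
open import Data.Vec.Properties using (lookup∘tabulate; []=⇒lookup; lookup⇒[]=)
open import Function using (_∘_; id; case_of_; _⇔_; mk⇔; Equivalence)
open import Relation.Binary.Construct.Closure.ReflexiveTransitive using (ε; _◅_)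
open import Relation.Binary.PropositionalEquality
open import Relation.Nullary using (¬_; Dec; yes; no; does)
open import Relation.Nullary.Decidable using (dec-true; dec-false; decidable-stable; _×-dec_; map′)


-- Graphs

x∈p─q⇒x∉q : ∀ {n} (p q : Subset n) {x} → x ∈ˢ p ─ q → ¬ x ∈ˢ q
x∈p─q⇒x∉q (_ ∷ p) (outside ∷ q) (there x∈) (there x∈q) = x∈p─q⇒x∉q p q x∈ x∈q
x∈p─q⇒x∉q (_ ∷ p) (inside ∷ q)  (there x∈) (there x∈q) = x∈p─q⇒x∉q p q x∈ x∈q

module _ {n : ℕ} (G : Graph n) where

  private
    V = Fin n

  open DecMembership (F._≟_ {n}) using (_∈?_)

  adj-sym : ∀ {u v} → Adj G u v → Adj G v u
  adj-sym {u} {v} = Graph.sym G u v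

  -- Cuts off everything before an occurrence of `z`. Loop erasure uses the inclusion of vertices
  -- and the preserved uniqueness, minimality the bound on the length.
  suffix : ∀ {u v z} (w : Walk G u v) → z ∈ vertices w →
    Σ[ q ∈ Walk G z v ] edges q ≤ edges w × (∀ {y} → y ∈ vertices q → y ∈ vertices w) ×
                        (Unique (vertices w) → Unique (vertices q))
  suffix ε       (here refl) = ε , z≤n , (λ y → y) , λ u → u
  suffix (e ◅ w) (here refl) = e ◅ w , ≤-refl , (λ y → y) , λ u → u
  suffix (e ◅ w) (there z∈w) with q , q≤w , q⊆w , unique ← suffix w z∈w =
    q , m≤n⇒m≤1+n q≤w , there ∘ q⊆w , λ where (_ ∷ u) → unique u

  first∈ : ∀ {u v} (w : Walk G u v) → u ∈ vertices w
  first∈ ε       = here refl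
  first∈ (_ ◅ _) = here refl

  last∈ : ∀ {u v} (w : Walk G u v) → v ∈ vertices w
  last∈ ε       = here refl
  last∈ (_ ◅ w) = there (last∈ w)

  erase : ∀ {Q : V → Set} {u v} (w : Walk G u v) → All Q (vertices w) →
    Σ[ p ∈ Path G u v ] All Q (vertices (walk p))
  erase ε qs = path ε ([] ∷ []) , qs
  erase {u = u} (e ◅ w) (q ∷ qs) with path w′ simple′ , qs′ ← erase w qs | u ∈? vertices w′
  ... | yes u∈ = let s , _ , s⊆ , unique = suffix w′ u∈ in
                 path s (unique simple′) , All.tabulate (All.lookup qs′ ∘ s⊆)
  ... | no u∉  = path (e ◅ w′) (All.¬Any⇒All¬ _ u∉ ∷ simple′) , q ∷ qs′

  -- Walks instead of simple paths, so that links compose by concatenation; `erase` recovers a path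
  -- with the same property.
  Linked : (V → Set) → V → V → Set
  Linked Q u v = Σ[ w ∈ Walk G u v ] All Q (vertices w)

  linked-refl : ∀ {Q : V → Set} {u} → Q u → Linked Q u u
  linked-refl q = ε , q ∷ []

  linked-◅ : ∀ {Q : V → Set} {u v t} → Q u → Adj G u v → Linked Q v t → Linked Q u t
  linked-◅ q e (w , qs) = e ◅ w , q ∷ qs

  linked-trans : ∀ {Q : V → Set} {u v t} → Linked Q u v → Linked Q v t → Linked Q u t
  linked-trans (ε     , _)      l = l
  linked-trans (e ◅ w , q ∷ qs) l = linked-◅ q e (linked-trans (w , qs) l)

  linked-last : ∀ {Q : V → Set} {u v} → Linked Q u v → Q v
  linked-last (w , qs) = All.lookup qs (last∈ w)

  linked-▻ : ∀ {Q : V → Set} {u v t} → Linked Q u v → Adj G v t → Q t → Linked Q u t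
  linked-▻ l e q = linked-trans l (linked-◅ (linked-last l) e (linked-refl q))

  linked-sym : ∀ {Q : V → Set} {u v} → Linked Q u v → Linked Q v u
  linked-sym (ε     , qs)     = ε , qs
  linked-sym (e ◅ w , q ∷ qs) = linked-▻ (linked-sym (w , qs)) (adj-sym e) q

  linked-map : ∀ {Q R : V → Set} {u v} → (∀ {z} → Q z → R z) → Linked Q u v → Linked R u v
  linked-map f (w , qs) = w , All.map f qs

  -- Any two vertices are joined through the hub `z`, so connectedness reduces to the choice of a
  -- hub.
  connectedOn : ∀ {S} z → (∀ u → u ∈ˢ S → Linked (_∈ˢ S) u z) → ConnectedOn G S
  connectedOn z hub u v u∈ v∈ = let w , qs = linked-trans (hub u u∈) (linked-sym (hub v v∈)) in erase w qs

  to-last : ∀ {u v z} (w : Walk G u v) → z ∈ vertices w → Linked (_∈ vertices w) z v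
  to-last w z∈ = let q , _ , q⊆w , _ = suffix w z∈ in q , All.tabulate q⊆w

  -- Deleting `t` from a simple path leaves at most two segments, each containing an end of the
  -- path, and `z` lies on one of them.
  to-end : ∀ {u v z t} (w : Walk G u v) → Unique (vertices w) → z ∈ vertices w → z ≢ t →
    let Q = λ y → y ∈ vertices w × y ≢ t in Linked Q z u ⊎ Linked Q z v
  to-end ε       _ (here refl) z≢t = inj₁ (linked-refl (here refl , z≢t))
  to-end (_ ◅ _) _ (here refl) z≢t = inj₁ (linked-refl (here refl , z≢t))
  to-end {u} {t = t} (e ◅ w) (u∉ ∷ simple) (there z∈) z≢t with to-end w simple z∈ z≢t
  ... | inj₂ l = inj₂ (linked-map (λ (y∈ , y≢t) → there y∈ , y≢t) l)
  ... | inj₁ l with u F.≟ t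
  ...   | no u≢t   = inj₁ (linked-▻ (linked-map (λ (y∈ , y≢t) → there y∈ , y≢t) l) (adj-sym e)
                                     (here refl , u≢t))
  -- Here `t` is the first vertex; by simplicity the rest of the walk avoids it and leads from `z`
  -- to the far end.
  ...   | yes refl = inj₂ (linked-map (λ y∈ → there y∈ , λ where refl → All.lookup u∉ y∈ refl)
                                      (to-last w z∈))

  -- Cycles and the blocks around them

  ⟦_⟧ : List V → Subset n
  ⟦ vs ⟧ = Vec.tabulate λ v → does (v ∈? vs)

  ∈⟦⟧⁺ : ∀ {v vs} → v ∈ vs → v ∈ˢ ⟦ vs ⟧
  ∈⟦⟧⁺ {v} {vs} v∈ = lookup⇒[]= v _ (trans (lookup∘tabulate _ v) (dec-true (v ∈? vs) v∈))

  ∈⟦⟧⁻ : ∀ {v vs} → v ∈ˢ ⟦ vs ⟧ → v ∈ vs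
  ∈⟦⟧⁻ {v} {vs} v∈ = decidable-stable (v ∈? vs) λ v∉ →
    case trans (sym (trans (lookup∘tabulate _ v) (dec-false (v ∈? vs) v∉))) ([]=⇒lookup v∈) of λ ()

  -- A cycle minus one vertex is a path: without `x`, the walk `w` remains; without another vertex
  -- `t`, every remaining vertex of `w` reaches `x` through an end of `w`.
  cycle-biconnected : ∀ {x a b} (w : Walk G a b) → Unique (vertices w) → All (_≢ x) (vertices w) →
    Adj G x a → Adj G x b → BiconnectedOn G ⟦ x ∷ vertices w ⟧
  cycle-biconnected {x} {a} {b} w simple avoids xa xb = connected , λ t (_ , ¬c) → ¬c (connected-without t)
    where
    S = ⟦ x ∷ vertices w ⟧
    connected : ConnectedOn G S
    connected = connectedOn b λ u u∈ → linked-map ∈⟦⟧⁺ (to-b u (∈⟦⟧⁻ u∈))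
      where
      to-b : ∀ u → u ∈ x ∷ vertices w → Linked (_∈ x ∷ vertices w) u b
      to-b u (here refl) = linked-◅ (here refl) xb (linked-refl (there (last∈ w)))
      to-b u (there u∈)  = linked-map there (to-last w u∈)
    Rest : V → V → Set
    Rest t y = y ∈ x ∷ vertices w × y ≢ t
    rest⁺ : ∀ {t y} → Rest t y → y ∈ˢ S - t
    rest⁺ (y∈ , y≢t) = x∈p∧x≢y⇒x∈p-y (∈⟦⟧⁺ y∈) y≢t
    rest⁻ : ∀ {t y} → y ∈ˢ S - t → Rest t y
    rest⁻ {t} y∈ = ∈⟦⟧⁻ (p─q⊆p S ⁅ t ⁆ y∈) , λ where refl → x∈p─q⇒x∉q S ⁅ t ⁆ y∈ (x∈⁅x⁆ t)
    to-hub : ∀ t → ∃[ z ] ∀ u → Rest t u → Linked (Rest t) u z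
    to-hub t with t F.≟ x
    ... | yes refl = b , λ where
      u (here refl , u≢x) → ⊥-elim (u≢x refl)
      u (there u∈  , _)   → linked-map (λ y∈ → there y∈ , All.lookup avoids y∈) (to-last w u∈)
    ... | no t≢x = x , λ where
        u (here refl , u≢t) → linked-refl (here refl , u≢t)
        u (there u∈  , u≢t) → close (to-end w simple u∈ u≢t)
      where
      close : ∀ {u} → Linked (λ y → y ∈ vertices w × y ≢ t) u a ⊎
                      Linked (λ y → y ∈ vertices w × y ≢ t) u b → Linked (Rest t) u x
      close (inj₁ l) = linked-▻ (linked-map (λ (y∈ , y≢t) → there y∈ , y≢t) l) (adj-sym xa)
                                (here refl , t≢x ∘ sym)
      close (inj₂ l) = linked-▻ (linked-map (λ (y∈ , y≢t) → there y∈ , y≢t) l) (adj-sym xb)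
                                (here refl , t≢x ∘ sym)
    connected-without : ∀ t → ConnectedOn G (S - t)
    connected-without t = let z , link = to-hub t in
      connectedOn z λ u u∈ → linked-map rest⁺ (link u (rest⁻ u∈))

  -- A set that is not maximal can be enlarged, and this stops because `k` bounds the number of
  -- vertices outside `S`. Maximality is never decided along the way, hence the double negation.
  block-above : ∀ S k → n ≤ ∣ S ∣ + k → BiconnectedOn G S → ¬ ¬ (∃[ B ] S ⊆ B × IsBlock G B)
  block-above S k bound bic none = none (S , (λ x∈ → x∈) , bic , λ S′ S⊆S′ bic′ {x} x∈S′ →
    decidable-stable (x ∈ˢ? S) λ x∉S → larger k bound S′ S⊆S′ bic′ (S⊆S′ , x , x∈S′ , x∉S))
    where
    larger : ∀ k → n ≤ ∣ S ∣ + k → ∀ S′ → S ⊆ S′ → BiconnectedOn G S′ → S ⊂ S′ → ⊥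
    larger zero bound S′ S⊆S′ bic′ S⊂S′ =
      <⇒≱ (p⊂q⇒∣p∣<∣q∣ S⊂S′) (≤-trans (∣p∣≤n S′) (≤-trans bound (≤-reflexive (+-identityʳ _))))
    larger (suc k) bound S′ S⊆S′ bic′ S⊂S′ =
      block-above S′ k (≤-trans bound (≤-trans (≤-reflexive (+-suc ∣ S ∣ k)) (+-monoˡ-≤ k (p⊂q⇒∣p∣<∣q∣ S⊂S′))))
        bic′ λ (B , S′⊆B , isBlock) → none (B , (λ x∈ → S′⊆B (S⊆S′ x∈)) , isBlock)

  Avoids : V → V → V → Set
  Avoids x = Linked (_≢ x)

  -- The cycle through `x`, `a` and `b` lies in a block, which is a clique. Adjacency is decidable,
  -- which removes the double negation around the block.
  neighbours-adjacent : IsBlockGraph G → ∀ {x a b} → Adj G x a → Adj G x b → a ≢ b → Avoids x a b → Adj G a b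
  neighbours-adjacent blockGraph {x} {a} {b} xa xb a≢b (w , avoids) with erase w avoids
  ... | path w′ simple′ , avoids′ = decidable-stable (T? (adj G a b)) λ ¬ab →
    block-above _ n (m≤n+m n _) (cycle-biconnected w′ simple′ avoids′ xa xb) λ (B , S⊆B , isBlock) →
      ¬ab (blockGraph B isBlock a b (S⊆B (∈⟦⟧⁺ (there (first∈ w′)))) (S⊆B (∈⟦⟧⁺ (there (last∈ w′)))) a≢b)

  -- Forked vertices and colour clashes

  Fork : V → V → V → Set
  Fork x a b = Adj G x a × Adj G x b × a ≢ b × ¬ Adj G a b

  Forked : V → Set
  Forked x = ∃[ a ] ∃[ b ] Fork x a b

  -- Of the two ends of a fork at x, at most one can be reached from y avoiding x,
  -- but which one is not decided.
  forked-separates : IsBlockGraph G → ∀ {x} y → Forked x → ¬ (∀ u → Adj G x u → ¬ ¬ Avoids x u y)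
  forked-separates blockGraph y (a , b , xa , xb , a≢b , ¬ab) all =
    all a xa λ ay → all b xb λ by →
      ¬ab (neighbours-adjacent blockGraph xa xb a≢b (linked-trans ay (linked-sym by)))

  ∈-allButLast : ∀ {u v z} (w : Walk G u v) → z ∈ vertices w → z ≢ v → z ∈ allButLast w
  ∈-allButLast ε       (here refl) z≢v = ⊥-elim (z≢v refl)
  ∈-allButLast (_ ◅ w) (here refl) z≢v = here refl
  ∈-allButLast (_ ◅ w) (there z∈)  z≢v = there (∈-allButLast w z∈ z≢v)

  ∈-internal : ∀ {u v z} (w : Walk G u v) → z ∈ vertices w → z ≢ u → z ≢ v → z ∈ internal w
  ∈-internal ε       (here refl) z≢u _   = ⊥-elim (z≢u refl)
  ∈-internal (_ ◅ w) (here refl) z≢u _   = ⊥-elim (z≢u refl)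
  ∈-internal (_ ◅ w) (there z∈)  _   z≢v = ∈-allButLast w z∈ z≢v

  visits : ∀ {u v x} (w : Walk G u v) → ¬ Avoids x u v → x ∈ vertices w
  visits {x = x} w blocked = decidable-stable (x ∈? vertices w) λ x∉ →
    blocked (w , All.map (_∘ sym) (All.¬Any⇒All¬ _ x∉))

  adj⇒≢ : ∀ {u v} → Adj G u v → u ≢ v
  adj⇒≢ e refl = Graph.irrefl G _ e

  -- A walk from `u` to `v` missing `x` could be prolonged by the edge from `v` to `y` and would
  -- link `u` to `y` around `x`; the case of `y` is symmetric. Moreover `x` is not `v`, since
  -- otherwise the trivial walk would link `v` to `x` around `y`.
  both-internal : ∀ {x y u v} → x ≢ y → Adj G x u → Adj G y v → ¬ Avoids x u y → ¬ Avoids y v x →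
    (w : Walk G u v) → x ∈ internal w × y ∈ internal w
  both-internal {x} {y} {u} {v} x≢y xu yv blockedˣ blockedʸ w =
    ∈-internal w (visits w uv) (adj⇒≢ xu) x≢v , ∈-internal w (visits w vu) y≢u (adj⇒≢ yv)
    where
    uv : ¬ Avoids x u v
    uv l = blockedˣ (linked-▻ l (adj-sym yv) (x≢y ∘ sym))
    vu : ¬ Avoids y u v
    vu l = blockedʸ (linked-▻ (linked-sym l) (adj-sym xu) x≢y)
    x≢v : x ≢ v
    x≢v refl = blockedʸ (linked-refl x≢y)
    y≢u : y ≢ u
    y≢u refl = blockedˣ (linked-refl (x≢y ∘ sym))

  module _ (ψ : V → ℕ) where

    Clash : Set
    Clash = ∃[ x ] ∃[ y ] x ≢ y × ψ x ≡ ψ y × Forked x × Forked y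

    clash⇒¬strong : IsBlockGraph G → Clash → ¬ StronglyRainbowVertexConnected G ψ
    clash⇒¬strong blockGraph (x , y , x≢y , ψx≡ψy , fx , fy) strong =
      -- The goal is absurdity, so the separated neighbours `u` and `v` may be taken as given,
      -- although which ends of the forks they are is undecided.
      forked-separates blockGraph y fx λ u xu blockedˣ →
      forked-separates blockGraph x fy λ v yv blockedʸ →
      let p , _ , rainbow = strong u v
          x∈ , y∈ = both-internal x≢y xu yv blockedˣ blockedʸ (walk p)
      in x≢y (injective rainbow x∈ y∈ ψx≡ψy)
      where
      injective : ∀ {xs x y} → Unique (map ψ xs) → x ∈ xs → y ∈ xs → ψ x ≡ ψ y → x ≡ y
      injective (_ ∷ _)  (here refl) (here refl) _  = refl
      injective (x∉ ∷ _) (here refl) (there y∈)  eq = ⊥-elim (All.lookup x∉ (∈-map⁺ ψ y∈) eq)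
      injective (y∉ ∷ _) (there x∈)  (here refl) eq = ⊥-elim (All.lookup y∉ (∈-map⁺ ψ x∈) (sym eq))
      injective (_ ∷ u)  (there x∈)  (there y∈)  eq = injective u x∈ y∈ eq

  -- Shortest walks

  WalkOfLength : ℕ → V → V → Set
  WalkOfLength k u v = Σ[ w ∈ Walk G u v ] edges w ≡ k

  walkOfLength? : ∀ k u v → Dec (WalkOfLength k u v)
  walkOfLength? zero    u v = map′ (λ where refl → ε , refl) (λ where (ε , _) → refl) (u F.≟ v)
  walkOfLength? (suc k) u v =
    map′ (λ (z , e , w , eq) → e ◅ w , cong suc eq) (λ where (e ◅ w , eq) → _ , e , w , suc-injective eq)
      (any? λ z → T? (adj G u z) ×-dec walkOfLength? k z v)

  least : ∀ {P : ℕ → Set} → (∀ k → Dec (P k)) → ∀ m → P m → ∃[ k ] P k × (∀ j → P j → k ≤ j)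
  least P? zero    p = 0 , p , λ _ _ → z≤n
  least P? (suc m) p with P? 0
  ... | yes p₀ = 0 , p₀ , λ _ _ → z≤n
  ... | no ¬p₀ with k , pk , min ← least (λ k → P? (suc k)) m p =
    suc k , pk , λ where
      zero    p₀ → ⊥-elim (¬p₀ p₀)
      (suc j) pj → s≤s (min j pj)

  -- The comparison is with all walks, not only simple ones: tails then inherit minimality by
  -- prepending an edge, and simplicity is a consequence.
  Minimal : ∀ {u v} → Walk G u v → Set
  Minimal {u} {v} w = ∀ (q : Walk G u v) → edges w ≤ edges q

  minimal-walk : ∀ {u v} → Walk G u v → Σ[ w ∈ Walk G u v ] Minimal w
  minimal-walk {u} {v} w
    with k , (q , refl) , min ← least (λ k → walkOfLength? k u v) (edges w) (w , refl) =
    q , λ r → min (edges r) (r , refl)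

  minimal-tail : ∀ {u z v} {e : Adj G u z} {w : Walk G z v} → Minimal (e ◅ w) → Minimal w
  minimal-tail {e = e} min q = s≤s⁻¹ (min (e ◅ q))

  -- If the first vertex recurred, the suffix from the later occurrence would be a shorter walk.
  minimal-simple : ∀ {u v} (w : Walk G u v) → Minimal w → Unique (vertices w)
  minimal-simple ε       min = [] ∷ []
  minimal-simple (e ◅ w) min =
    All.¬Any⇒All¬ _ (λ u∈ → let q , q≤w , _ = suffix w u∈ in 1+n≰n (≤-trans (min q) q≤w)) ∷
    minimal-simple w (minimal-tail {e = e} {w} min)

  -- The predecessor and the successor of an internal vertex form the fork: an edge between them, or
  -- their equality, would give a shortcut.
  minimal-forked : ∀ {u v} (w : Walk G u v) → Minimal w → All Forked (internal w)
  minimal-forked ε       _   = []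
  minimal-forked (e ◅ w) min = go e w min
    where
    go : ∀ {u z v} (e : Adj G u z) (w : Walk G z v) → Minimal (e ◅ w) → All Forked (allButLast w)
    go e ε                 _   = []
    go {u} e (_◅_ {j = y} f w) min =
      (u , y , adj-sym e , f , u≢y , λ g → 1+n≰n (min (g ◅ w))) ∷ go f w (minimal-tail {e = e} {f ◅ w} min)
      where
      u≢y : u ≢ y
      u≢y refl = 1+n≰n (≤-trans (n≤1+n _) (min w))

  unique-allButLast : ∀ {u v} (w : Walk G u v) → Unique (vertices w) → Unique (allButLast w)
  unique-allButLast ε       _        = []
  unique-allButLast (_ ◅ w) (u∉ ∷ u) = All-allButLast w u∉ ∷ unique-allButLast w u
    where
    All-allButLast : ∀ {Q : V → Set} {u v} (w : Walk G u v) → All Q (vertices w) → All Q (allButLast w)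
    All-allButLast ε       _        = []
    All-allButLast (_ ◅ w) (q ∷ qs) = q ∷ All-allButLast w qs

  unique-internal : ∀ {u v} (w : Walk G u v) → Unique (vertices w) → Unique (internal w)
  unique-internal ε       _       = []
  unique-internal (_ ◅ w) (_ ∷ u) = unique-allButLast w u

  ¬clash⇒strong : ∀ ψ → Connected G → ¬ Clash ψ → StronglyRainbowVertexConnected G ψ
  ¬clash⇒strong ψ connected ¬clash u v
    with w , min ← minimal-walk (walk (proj₁ (connected u v ∈⊤ ∈⊤))) =
    p , ((p , refl) , λ q → min (walk q)) ,
    AllPairs.map⁺ (rainbow (unique-internal w simple′) (minimal-forked w min))
    where
    simple′ = minimal-simple w min
    p = path w simple′
    rainbow : ∀ {xs} → Unique xs → All Forked xs → AllPairs (λ x y → ψ x ≢ ψ y) xs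
    rainbow []       []       = []
    rainbow (x∉ ∷ u) (f ∷ fs) =
      All.zipWith (λ (x≢y , fy) eq → ¬clash (_ , _ , x≢y , eq , f , fy)) (x∉ , fs) ∷ rainbow u fs

-- Structured programs for the random access machine

-- Registers with explicit values in front of a heap: address a of the heap is
-- machine address length regs + a, so that accesses to both compute.
record State : Set where
  constructor ⟨_,_,_⟩
  field
    regs  : List ℕ
    heap  : ℕ → ℕ
    input : List Bool

open State

peek : List ℕ → (ℕ → ℕ) → ℕ → ℕ
peek []       h a       = h a
peek (v ∷ r)  h zero    = v
peek (v ∷ r)  h (suc a) = peek r h a

pokeRegs : List ℕ → ℕ → ℕ → List ℕ
pokeRegs []      a       x = []
pokeRegs (v ∷ r) zero    x = x ∷ r
pokeRegs (v ∷ r) (suc a) x = v ∷ pokeRegs r a x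

pokeHeap : List ℕ → (ℕ → ℕ) → ℕ → ℕ → ℕ → ℕ
pokeHeap []      h a       x = h [ a ↦ x ]
pokeHeap (v ∷ r) h zero    x = h
pokeHeap (v ∷ r) h (suc a) x = pokeHeap r h a x

-- The right-hand side has the form of the machine's memory update, so a state changes exactly as
-- the memory it represents.
peek-poke : ∀ r h a x b →
  peek (pokeRegs r a x) (pokeHeap r h a x) b ≡ (if b ≡ᵇ a then x else peek r h b)
peek-poke []      h a       x b       = refl
peek-poke (v ∷ r) h zero    x zero    = refl
peek-poke (v ∷ r) h zero    x (suc b) = refl
peek-poke (v ∷ r) h (suc a) x zero    = refl
peek-poke (v ∷ r) h (suc a) x (suc b) = peek-poke r h a x b

infix 8 _!_
_!_ : State → ℕ → ℕ
s ! a = peek (regs s) (heap s) a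

poke : ℕ → ℕ → List Bool → State → State
poke a x inp s = ⟨ pokeRegs (regs s) a x , pokeHeap (regs s) (heap s) a x , inp ⟩

bit : Bool → ℕ
bit b = if b then 1 else 0

-- The instructions that always pass control to the next one, so that a straight-line block acts on
-- states by computation.
data Op : Set where
  const           : (d c : ℕ) → Op
  add sub         : (d i j : ℕ) → Op
  load            : (d i : ℕ) → Op
  store           : (i j : ℕ) → Op
  read            : (d : ℕ) → Op

instr : Op → Instr
instr (const d c) = const d c
instr (add d i j) = add d i j
instr (sub d i j) = sub d i j
instr (load d i)  = load d i
instr (store i j) = store i j
instr (read d)    = read d

readInto : ℕ → List Bool → State → State
readInto d []         s = poke d 0 [] s
readInto d (b ∷ rest) s = poke d (bit b) rest s

apply : Op → State → State
apply (const d c) s = poke d c (input s) s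
apply (add d i j) s = poke d (s ! i + s ! j) (input s) s
apply (sub d i j) s = poke d (s ! i ∸ s ! j) (input s) s
apply (load d i)  s = poke d (s ! (s ! i)) (input s) s
apply (store i j) s = poke (s ! i) (s ! j) (input s) s
apply (read d)    s = readInto d (input s) s

applyAll : List Op → State → State
applyAll []       s = s
applyAll (o ∷ os) s = applyAll os (apply o s)

infix 4 _∼_
-- Agreement is pointwise because memories with the same contents need not be identical as
-- functions.
record _∼_ (X : Memory) (s : State) : Set where
  constructor agreeing
  field
    at : ∀ a → X a ≡ s ! a

open _∼_

∼-poke : ∀ {X s} inp a {x y} → X ∼ s → x ≡ y → X [ a ↦ x ] ∼ poke a y inp s
∼-poke {X} {s} inp a {x} X∼s refl = agreeing λ b →
  trans (cong (if b ≡ᵇ a then x else_) (at X∼s b))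
        (sym (peek-poke (regs s) (heap s) a x b))

-- Timed executions and their composition

module _ (P : Program) where

  -- A timed reachability statement between two program counters. Since `runs` holds for every
  -- amount `k` of leftover fuel, consecutive runs compose by adding their steps.
  record Reaches (pc : ℕ) (X : Memory) (s : State) (t : ℕ) (pc′ : ℕ) (Q : State → Set) : Set where
    constructor reaches
    field
      {steps}  : ℕ
      {memory} : Memory
      {final}  : State
      inTime   : steps ≤ t
      holds    : Q final
      agree    : memory ∼ final
      runs     : ∀ k → run P (steps + k) pc X (input s) ≡ run P k pc′ memory (input final)

  Placed : ℕ → List Instr → Set
  Placed pc is = ∃[ pre ] ∃[ post ] P ≡ pre ++ is ++ post × length pre ≡ pc

open Reaches

fetch-++ : ∀ pre i post → fetch (pre ++ i ∷ post) (length pre) ≡ i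
fetch-++ []        i post = refl
fetch-++ (_ ∷ pre) i post = fetch-++ pre i post

module _ {P : Program} where

  placed-fetch : ∀ {pc i is} → Placed P pc (i ∷ is) → fetch P pc ≡ i
  placed-fetch (pre , post , refl , refl) = fetch-++ pre _ _

  placed-++ˡ : ∀ {pc} is {js} → Placed P pc (is ++ js) → Placed P pc is
  placed-++ˡ is {js} (pre , post , eq , len) =
    pre , js ++ post , trans eq (cong (pre ++_) (++-assoc is js post)) , len

  placed-++ʳ : ∀ {pc} is {js} → Placed P pc (is ++ js) → Placed P (pc + length is) js
  placed-++ʳ is {js} (pre , post , eq , refl) =
    pre ++ is , post ,
    trans eq (trans (cong (pre ++_) (++-assoc is js post)) (sym (++-assoc pre is (js ++ post)))) ,
    length-++ pre

  placed-tail : ∀ {pc i is} → Placed P pc (i ∷ is) → Placed P (suc pc) is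
  placed-tail {pc} {i} {is} p = subst (λ l → Placed P l is) (+-comm pc 1) (placed-++ʳ (i ∷ []) {_} p)

  stay : ∀ {pc X s Q} → X ∼ s → Q s → Reaches P pc X s 0 pc Q
  stay X∼s q = reaches z≤n q X∼s (λ k → refl)

  infixr 5 _then_
  _then_ : ∀ {pc pc′ pc″ X s t t′ Q Q′} → Reaches P pc X s t pc′ Q →
    (∀ {X′ s′} → X′ ∼ s′ → Q s′ → Reaches P pc′ X′ s′ t′ pc″ Q′) →
    Reaches P pc X s (t + t′) pc″ Q′
  _then_ {pc} {X = X} {s} r next =
    reaches (+-mono-≤ (inTime r) (inTime r′)) (holds r′) (agree r′)
      λ k → trans (cong (λ m → run P m pc X (input s)) (+-assoc (steps r) (steps r′) k))
              (trans (runs r (steps r′ + k)) (runs r′ k))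
    where r′ = next (agree r) (holds r)

  effect : Op → Memory → List Bool → Memory
  effect (const d c) X _       = X [ d ↦ c ]
  effect (add d i j) X _       = X [ d ↦ X i + X j ]
  effect (sub d i j) X _       = X [ d ↦ X i ∸ X j ]
  effect (load d i)  X _       = X [ d ↦ X (X i) ]
  effect (store i j) X _       = X [ X i ↦ X j ]
  effect (read d)    X []      = X [ d ↦ 0 ]
  effect (read d)    X (b ∷ _) = X [ d ↦ bit b ]

  effect-∼ : ∀ o {X s} → X ∼ s → effect o X (input s) ∼ apply o s
  effect-∼ (const d c) {s = s} X∼s = ∼-poke (input s) d X∼s refl
  effect-∼ (add d i j) {s = s} X∼s = ∼-poke (input s) d X∼s (cong₂ _+_ (at X∼s i) (at X∼s j))
  effect-∼ (sub d i j) {s = s} X∼s = ∼-poke (input s) d X∼s (cong₂ _∸_ (at X∼s i) (at X∼s j))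
  effect-∼ (load d i)  {s = s} X∼s = ∼-poke (input s) d X∼s (trans (at X∼s _) (cong (s !_) (at X∼s i)))
  effect-∼ (store i j) {X} {s} X∼s =
    subst (λ a → X [ a ↦ X j ] ∼ _) (sym (at X∼s i)) (∼-poke (input s) (s ! i) X∼s (at X∼s j))
  effect-∼ (read d) {s = ⟨ _ , _ , [] ⟩}    X∼s = ∼-poke [] d X∼s refl
  effect-∼ (read d) {s = ⟨ _ , _ , _ ∷ r ⟩} X∼s = ∼-poke r d X∼s refl

  run-op : ∀ o {pc} s {X} → fetch P pc ≡ instr o → ∀ k →
    run P (suc k) pc X (input s) ≡
    run P k (suc pc) (effect o X (input s)) (input (apply o s))
  run-op (const d c) s eq k rewrite eq = refl
  run-op (add d i j) s eq k rewrite eq = refl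
  run-op (sub d i j) s eq k rewrite eq = refl
  run-op (load d i)  s eq k rewrite eq = refl
  run-op (store i j) s eq k rewrite eq = refl
  run-op (read d) ⟨ _ , _ , [] ⟩    eq k rewrite eq = refl
  run-op (read d) ⟨ _ , _ , _ ∷ _ ⟩ eq k rewrite eq = refl

  step : ∀ o {pc X s} → fetch P pc ≡ instr o → X ∼ s → Reaches P pc X s 1 (suc pc) (apply o s ≡_)
  step o {s = s} eq X∼s = reaches ≤-refl refl (effect-∼ o X∼s) (run-op o s eq)

  run-jump-zero : ∀ {i l pc X inp} → fetch P pc ≡ jump i l → X i ≡ 0 → ∀ k →
    run P (suc k) pc X inp ≡ run P k (suc pc) X inp
  run-jump-zero eq z k rewrite eq | z = refl

  run-jump-suc : ∀ {i l v pc X inp} → fetch P pc ≡ jump i l → X i ≡ suc v → ∀ k →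
    run P (suc k) pc X inp ≡ run P k l X inp
  run-jump-suc eq z k rewrite eq | z = refl

  jump-stays : ∀ {i l pc X s} {Q : State → Set} → fetch P pc ≡ jump i l → X ∼ s → s ! i ≡ 0 → Q s →
    Reaches P pc X s 1 (suc pc) Q
  jump-stays {i} eq X∼s z q = reaches ≤-refl q X∼s (run-jump-zero {i} eq (trans (at X∼s i) z))

  jump-goes : ∀ {i l v pc X s} {Q : State → Set} → fetch P pc ≡ jump i l → X ∼ s → s ! i ≡ suc v → Q s →
    Reaches P pc X s 1 l Q
  jump-goes {i} {pc = pc} eq X∼s z q = reaches ≤-refl q X∼s (run-jump-suc {i} {pc = pc} eq (trans (at X∼s i) z))

-- Structured commands and their timed proof rules

infixr 6 _⨾_
data Cmd : Set where
  block  : List Op → Cmd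
  _⨾_    : Cmd → Cmd → Cmd
  unless : ℕ → Cmd → Cmd     -- the body runs if the register is zero
  repeat : Cmd → ℕ → Cmd     -- the body runs until the register is zero, at least once

-- Jump targets are absolute, so the code of a command depends on the address at which it will
-- stand.
code : ℕ → Cmd → List Instr
code pc (block os)   = map instr os
code pc (c ⨾ d)      = code pc c ++ code (pc + length (code pc c)) d
code pc (unless i c) = jump i (suc pc + length (code (suc pc) c)) ∷ code (suc pc) c
code pc (repeat c i) = code pc c ++ jump i pc ∷ []

-- A Hoare triple with time bound `t` for a single initial state, valid wherever the code is placed
-- in any program.
record Does (c : Cmd) (t : ℕ) (s : State) (Q : State → Set) : Set where
  constructor doing
  field
    exec : ∀ {P pc X} → Placed P pc (code pc c) → X ∼ s →
           Reaches P pc X s t (pc + length (code pc c)) Q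

open Does

does-weaken : ∀ {c t t′ s} {Q Q′ : State → Set} → t ≤ t′ → (∀ {s} → Q s → Q′ s) →
  Does c t s Q → Does c t′ s Q′
does-weaken t≤t′ f d = doing λ p X∼s → let r = exec d p X∼s in
  reaches (≤-trans (inTime r) t≤t′) (f (holds r)) (agree r) (runs r)

does-block : ∀ os {s} {Q : State → Set} → Q (applyAll os s) → Does (block os) (length os) s Q
does-block os {Q = Q} q = doing λ p X∼s → go os p X∼s q
  where
  go : ∀ {P} os {pc X s} → Placed P pc (map instr os) → X ∼ s → Q (applyAll os s) →
       Reaches P pc X s (length os) (pc + length (map instr os)) Q
  go {P} [] {pc} {X} {s} p X∼s q =
    subst (λ l → Reaches P pc X s 0 l Q) (sym (+-identityʳ pc)) (stay X∼s q)
  go {P} (o ∷ os) {pc} {X} {s} p X∼s q =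
    subst (λ l → Reaches P pc X s (suc (length os)) l Q) (sym (+-suc pc _))
      (step o (placed-fetch p) X∼s then λ where X∼s′ refl → go os (placed-tail p) X∼s′ q)

does-⨾ : ∀ {c d t t′ s Q Q′} → Does c t s Q → (∀ {s′} → Q s′ → Does d t′ s′ Q′) →
  Does (c ⨾ d) (t + t′) s Q′
does-⨾ {c} {d} {t} {t′} {s} {Q′ = Q′} C D = doing λ {P} {pc} {X} p X∼s →
  let cs = code pc c in
  subst (λ l → Reaches P pc X s (t + t′) l Q′)
    (trans (+-assoc pc (length cs) _) (cong (pc +_) (sym (length-++ cs))))
    (exec C (placed-++ˡ cs p) X∼s then λ X∼s′ q → exec (D q) (placed-++ʳ cs p) X∼s′)

does-to : ∀ os {s} s′ {Q : State → Set} → applyAll os s ≡ s′ → Q s′ → Does (block os) (length os) s Q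
does-to os s′ refl = does-block os

does-ops : ∀ os {s} s′ → applyAll os s ≡ s′ → Does (block os) (length os) s (s′ ≡_)
does-ops os s′ eq = does-to os s′ eq refl

after : ∀ os {c t s} s′ {Q} → applyAll os s ≡ s′ → Does c t s′ Q →
  Does (block os ⨾ c) (length os + t) s Q
after os s′ refl C = does-⨾ (does-ops os s′ refl) λ where refl → C

does-unless-zero : ∀ {i c t s Q} → s ! i ≡ 0 → Does c t s Q → Does (unless i c) (suc t) s Q
does-unless-zero {i} {c} {t} {s} {Q} z C = doing λ {P} {pc} {X} p X∼s →
  subst (λ l → Reaches P pc X s (suc t) l Q) (sym (+-suc pc _))
    (jump-stays {Q = s ≡_} (placed-fetch p) X∼s z refl then
       λ where X∼s′ refl → exec C (placed-tail p) X∼s′)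

does-unless-suc : ∀ {i c v s} {Q : State → Set} → s ! i ≡ suc v → Q s → Does (unless i c) 1 s Q
does-unless-suc {i} {c} {v} {s} {Q} z q = doing λ {P} {pc} {X} p X∼s →
  subst (λ l → Reaches P pc X s 1 l Q) (sym (+-suc pc _)) (jump-goes (placed-fetch p) X∼s z q)

-- Only one pass is unrolled; if the loop goes on, the premise supplies a triple for the same loop
-- from the new state. Induction on the number of passes thus stays with the caller. The extra step
-- is the closing jump.
does-repeat : ∀ {i c t t′ s Q Q′} → Does c t s Q →
  (∀ {s′} → Q s′ → s′ ! i ≡ 0 × Q′ s′ ⊎
                   (∃[ v ] s′ ! i ≡ suc v) × Does (repeat c i) t′ s′ Q′) →
  Does (repeat c i) (t + suc t′) s Q′
does-repeat {i} {c} {t} {t′} {s} {Q} {Q′} C next = doing go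
  where
  go : ∀ {P pc X} → Placed P pc (code pc (repeat c i)) → X ∼ s →
       Reaches P pc X s (t + suc t′) (pc + length (code pc (repeat c i))) Q′
  go {P} {pc} {X} p X∼s = exec C (placed-++ˡ cs p) X∼s then loop
    where
    cs = code pc c
    end : suc (pc + length cs) ≡ pc + length (cs ++ jump i pc ∷ [])
    end = trans (sym (+-suc pc _)) (cong (pc +_) (trans (+-comm 1 _) (sym (length-++ cs))))
    jmp : fetch P (pc + length cs) ≡ jump i pc
    jmp = placed-fetch (placed-++ʳ cs p)
    loop : ∀ {X′ s′} → X′ ∼ s′ → Q s′ →
      Reaches P (pc + length cs) X′ s′ (suc t′) (pc + length (code pc (repeat c i))) Q′
    loop {X′} {s′} X∼s′ q with next q
    ... | inj₁ (z , q′) = subst (λ l → Reaches P (pc + length cs) X′ s′ (suc t′) l Q′) end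
            (jump-stays {Q = s′ ≡_} jmp X∼s′ z refl then
              λ where X∼s″ refl → reaches z≤n q′ X∼s″ (λ _ → refl))
    ... | inj₂ ((v , z) , R) = jump-goes {Q = s′ ≡_} jmp X∼s′ z refl then
              λ where X∼s″ refl → exec R p X∼s″

-- Register 0 is scratch.  The loop variable counts down from n - 1 to 0.
initFor : ℕ → ℕ → List Op
initFor i n = const 0 0 ∷ add i 0 n ∷ const 0 1 ∷ sub 0 0 n ∷ []

decFor : ℕ → List Op
decFor i = const 0 1 ∷ sub i i 0 ∷ []

-- As `repeat` runs its body at least once, an empty range is skipped by testing register 0, which
-- `initFor` leaves at 1 minus the bound, truncated.
for : ℕ → ℕ → Cmd → Cmd
for i n c = block (initFor i n) ⨾ unless 0 (repeat (block (decFor i) ⨾ c) i)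

-- `Inv j` describes the state with `j` passes still to come. The 5 counts the four initial
-- instructions and the guard, the 3 the two instructions of the decrement and the closing jump.
does-for : ∀ {i n c t s} (Inv : ℕ → State → Set) (N : ℕ) →
  (let s₀ = applyAll (initFor i n) s) →
  s₀ ! 0 ≡ 1 ∸ N →
  (∀ {j s} → Inv j s → s ! i ≡ j) →
  Inv N s₀ →
  (∀ j {s} → j < N → Inv (suc j) s → Does c t (applyAll (decFor i) s) (Inv j)) →
  Does (for i n c) (5 + N * (3 + t)) s (Inv 0)
does-for {i} {n} {c} {t} {s} Inv N guard index start body =
  does-⨾ (does-block (initFor i n) {Q = applyAll (initFor i n) s ≡_} refl)
    λ where refl → rest N ≤-refl guard start
  where
  loop : ∀ j {s} → j < N → Inv (suc j) s →
    Does (repeat (block (decFor i) ⨾ c) i) (suc j * (3 + t)) s (Inv 0)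
  loop j {s} j<N inv = does-weaken (≤-reflexive (cong (2 +_) (+-suc t _))) (λ q → q)
    (does-repeat
      (does-⨾ (does-block (decFor i) {Q = applyAll (decFor i) s ≡_} refl)
              λ where refl → body j j<N inv)
      (again j j<N))
    where
    again : ∀ j {s} → j < N → Inv j s → s ! i ≡ 0 × Inv 0 s ⊎
            (∃[ v ] s ! i ≡ suc v) × Does (repeat (block (decFor i) ⨾ c) i) (j * (3 + t)) s (Inv 0)
    again zero    _   q = inj₁ (index q , q)
    again (suc j) j<N q = inj₂ ((j , index q) , loop j (<-trans (n<1+n j) j<N) q)
  rest : ∀ M {s} → M ≤ N → s ! 0 ≡ 1 ∸ M → Inv M s →
    Does (unless 0 (repeat (block (decFor i) ⨾ c) i)) (suc (M * (3 + t))) s (Inv 0)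
  rest zero    _   z inv = does-unless-suc z inv
  rest (suc M) M≤N z inv = does-unless-zero (trans z (0∸n≡0 M)) (loop M M≤N inv)

-- From commands to decision programs

decider : Cmd → ℕ → Program
decider c i = code 0 c ++ jump i (2 + length (code 0 c)) ∷ halt true ∷ halt false ∷ []

start : ℕ → List Bool → State
start r inp = ⟨ replicate r 0 , (λ _ → 0) , inp ⟩

zero-∼ : ∀ r {inp} → (λ _ → 0) ∼ start r inp
zero-∼ r {inp} = agreeing (go r)
  where
  go : ∀ r a → 0 ≡ start r inp ! a
  go zero    a       = refl
  go (suc r) zero    = refl
  go (suc r) (suc a) = go r a

run-halt : ∀ P pc X inp {b} → fetch P pc ≡ halt b → ∀ k → run P (suc k) pc X inp ≡ just b
run-halt P pc X inp eq k rewrite eq = refl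

outcome-decider : ∀ r {c i t u v inp} → Does c t (start r inp) (λ σ → σ ! i ≡ v) → 2 + t ≤ u →
  outcome (decider c i) inp u ≡ just (v ≡ᵇ 0)
outcome-decider r {c} {i} {t} {u} {v} {inp} C t≤u =
  trans (cong (λ u → outcome P inp u) (sym fuel))
    (trans (runs R (2 + k)) (answer v (trans (at (agree R) i) (holds R))))
  where
  P = decider c i
  N = length (code 0 c)
  R : Reaches P 0 (λ _ → 0) (start r inp) t N (λ σ → σ ! i ≡ v)
  R = exec C ([] , _ , refl , refl) (zero-∼ r)
  placed : Placed P N (jump i (2 + N) ∷ halt true ∷ halt false ∷ [])
  placed = code 0 c , [] , refl , refl
  k : ℕ
  -- The fuel left after the run of `c`, the final jump and the `halt`.
  k = u ∸ (2 + steps R)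
  fuel : steps R + (2 + k) ≡ u
  fuel = trans (sym (+-assoc (steps R) 2 k))
           (trans (cong (_+ k) (+-comm (steps R) 2))
             (m+[n∸m]≡n (≤-trans (+-monoʳ-≤ 2 (inTime R)) t≤u)))
  answer : ∀ v {X inp} → X i ≡ v → run P (2 + k) N X inp ≡ just (v ≡ᵇ 0)
  answer zero {X} {inp} z =
    trans (run-jump-zero {P} {pc = N} {X} {inp} (placed-fetch placed) z (suc k))
          (run-halt P (1 + N) X inp (placed-fetch (placed-tail placed)) k)
  answer (suc v) {X} {inp} z =
    trans (run-jump-suc {P} {pc = N} {X} {inp} (placed-fetch placed) z (suc k))
          (run-halt P (2 + N) X inp (placed-fetch (placed-tail (placed-tail placed))) k)

-- The decision procedure

-- The value is accumulated in register 5, the weight of the current digit is in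
-- register 8 and register 7 stays 0, so that loading from address 7 + s adds the
-- weight once more exactly if the second bit s of the digit is 1.
readDigit : Cmd
readDigit =
  block (read 6 ∷ const 0 1 ∷ sub 0 0 6 ∷ []) ⨾
  unless 0 (block (add 5 5 8 ∷ read 9 ∷
                   const 10 7 ∷ add 10 10 9 ∷ load 10 10 ∷ add 5 5 10 ∷ add 8 8 8 ∷ []))

readNumber : Cmd
readNumber = block (const 5 0 ∷ const 7 0 ∷ const 8 1 ∷ []) ⨾ repeat readDigit 6

-- The memory during input: register 1 holds the order n, 2 the write pointer,
-- 4 the number n * n.  The heap starts at address 16 and receives the adjacency
-- matrix row by row, then the colours.
reading : (z n e i m v r w s t : ℕ) → (ℕ → ℕ) → List Bool → State
reading z n e i m v r w s t h inp =
  ⟨ z ∷ n ∷ e ∷ i ∷ m ∷ v ∷ r ∷ 0 ∷ w ∷ s ∷ t ∷ 0 ∷ 0 ∷ 0 ∷ 0 ∷ 0 ∷ [] , h , inp ⟩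

Value : (n e i m v : ℕ) → (ℕ → ℕ) → List Bool → State → Set
Value n e i m v h inp σ = ∃[ z ] ∃[ r ] ∃[ w ] ∃[ s ] ∃[ t ] σ ≡ reading z n e i m v r w s t h inp

-- The digits come least significant first: with `v` accumulated and `w` the weight of the next
-- digit, `v + w * toℕᵇ b` is invariant. A digit costs 12 steps and its two bits are charged 24; the
-- end marker costs 5 and is charged 12.
does-digits : ∀ b {z n e i m v r w s t h rest u} → v + w * toℕᵇ b ≡ u →
  Does (repeat readDigit 6) (length (encodeℕᵇ b) * 12)
       (reading z n e i m v r w s t h (encodeℕᵇ b ++ rest)) (Value n e i m u h rest)
does-digits zeroᵇ {n = n} {e} {i} {m} {v} {r} {w} {s} {t} {h} {rest} refl =
  does-weaken (m≤n+m 5 7) (λ q → q)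
    (does-repeat {t′ = 0} {Q = reached ≡_}
      (after _ reached refl (does-unless-suc {Q = reached ≡_} refl refl))
      λ where refl → inj₁ (refl , _ , _ , _ , _ , _ , cong (λ v → reading _ _ _ _ _ v _ _ _ _ _ _)
                                       (sym (trans (cong (v +_) (*-zeroʳ w)) (+-identityʳ v)))))
  where reached = reading 1 n e i m v 0 w s t h rest
does-digits 2[1+ b ] {n = n} {e} {i} {m} {v} {r} {w} {s} {t} {h} {rest} refl =
  does-weaken (m≤n+m _ 12) (λ q → q)
    (does-repeat {Q = reached ≡_}
      (after _ (reading 0 n e i m v 1 w s t h (true ∷ encodeℕᵇ b ++ rest)) refl
        (does-unless-zero refl (does-ops _ reached refl)))
      λ where refl → inj₂ ((0 , refl) , does-digits b (digit v w (toℕᵇ b))))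
  where
  reached = reading 0 n e i m (v + w + w) 1 (w + w) 1 w h (encodeℕᵇ b ++ rest)
  digit : ∀ v w b → v + w + w + (w + w) * b ≡ v + w * (2 * suc b)
  digit = solve 3 (λ v w b → v :+ w :+ w :+ (w :+ w) :* b := v :+ w :* (con 2 :* (con 1 :+ b))) refl
    where open +-*-Solver
does-digits 1+[2 b ] {n = n} {e} {i} {m} {v} {r} {w} {s} {t} {h} {rest} refl =
  does-weaken (m≤n+m _ 12) (λ q → q)
    (does-repeat {Q = reached ≡_}
      (after _ (reading 0 n e i m v 1 w s t h (false ∷ encodeℕᵇ b ++ rest)) refl
        (does-unless-zero refl (does-ops _ reached refl)))
      λ where refl → inj₂ ((0 , refl) , does-digits b (digit v w (toℕᵇ b))))
  where
  reached = reading 0 n e i m (v + w + 0) 1 (w + w) 0 0 h (encodeℕᵇ b ++ rest)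
  digit : ∀ v w b → v + w + 0 + (w + w) * b ≡ v + w * suc (2 * b)
  digit = solve 3 (λ v w b → v :+ w :+ con 0 :+ (w :+ w) :* b := v :+ w :* (con 1 :+ con 2 :* b)) refl
    where open +-*-Solver

does-readNumber : ∀ k {z n e i m v r w s t h rest} →
  Does readNumber (3 + length (encodeℕ k) * 12)
       (reading z n e i m v r w s t h (encodeℕ k ++ rest)) (Value n e i m k h rest)
does-readNumber k {n = n} {e} {i} {m} {s = s} {t} {h} {rest} =
  after _ (reading _ n e i m 0 _ 1 s t h (encodeℕ k ++ rest)) refl
    (does-digits (fromℕ k) (trans (*-identityˡ _) (toℕ-fromℕ k)))

write : (ℕ → ℕ) → ℕ → List ℕ → ℕ → ℕ
write h q []       = h
write h q (v ∷ vs) = write (h [ q ↦ v ]) (suc q) vs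

-- Multiplication by repeated addition; the result bounds the loop that reads the matrix and later
-- locates the colours.
does-square : ∀ {z n e i v r w s t h inp} →
  Does (for 3 1 (block (add 4 4 1 ∷ []))) (5 + n * (3 + 1)) (reading z n e i 0 v r w s t h inp)
       (λ σ → ∃[ z ] σ ≡ reading z n e 0 (n * n) v r w s t h inp)
does-square {n = n} {e} {v = v} {r} {w} {s} {t} {h} {inp} =
  does-weaken ≤-refl finish
    (does-for Inv n refl (λ where (_ , _ , _ , refl) → refl) (_ , _ , refl , refl)
      λ where j _ (z , m , eq , refl) →
                 does-block (add 4 4 1 ∷ []) (_ , _ , trans (+-assoc m n (j * n)) eq , refl))
  where
  Inv : ℕ → State → Set
  Inv j σ = ∃[ z ] ∃[ m ] m + j * n ≡ n * n × σ ≡ reading z n e j m v r w s t h inp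
  finish : ∀ {σ} → Inv 0 σ → ∃[ z ] σ ≡ reading z n e 0 (n * n) v r w s t h inp
  finish (z , m , eq , refl) =
    z , cong (λ m → reading _ _ _ _ m _ _ _ _ _ _ _) (trans (sym (+-identityʳ m)) eq)

does-bits : ∀ bs {z n q i v r w s t h rest} →
  Does (for 3 4 (block (read 6 ∷ store 2 6 ∷ const 0 1 ∷ add 2 0 2 ∷ [])))
       (5 + length bs * (3 + 4))
       (reading z n (16 + q) i (length bs) v r w s t h (bs ++ rest))
       (λ σ → ∃[ z ] ∃[ r ] σ ≡ reading z n (16 + (q + length bs)) 0 (length bs) v r w s t
                                  (write h q (map bit bs)) rest)
does-bits bs {n = n} {q} {v = v} {w = w} {s} {t} {h} {rest} =
  does-weaken ≤-refl finish
    (does-for Inv (length bs) refl (λ where (_ , _ , _ , _ , _ , _ , _ , _ , refl) → refl)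
      (_ , _ , q , h , bs , refl , refl , refl , refl)
      λ where
        _ _ (z , r , q , h , b ∷ todo , refl , eq , eqh , refl) →
          does-block (read 6 ∷ store 2 6 ∷ const 0 1 ∷ add 2 0 2 ∷ [])
            (_ , _ , suc q , _ , todo , refl , trans (sym (+-suc q _)) eq , eqh , refl))
  where
  H = write h q (map bit bs)
  Inv : ℕ → State → Set
  Inv j σ = ∃[ z ] ∃[ r ] ∃[ q′ ] ∃[ h′ ] ∃[ todo ] length todo ≡ j × q′ + j ≡ q + length bs ×
            write h′ q′ (map bit todo) ≡ H ×
            σ ≡ reading z n (16 + q′) j (length bs) v r w s t h′ (todo ++ rest)
  finish : ∀ {σ} → Inv 0 σ → _
  finish (z , r , q , h , [] , refl , eq , eqh , refl) =
    z , r , cong₂ (λ q h → reading _ _ (16 + q) _ _ _ _ _ _ _ h _) (trans (sym (+-identityʳ q)) eq) eqh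

-- The loop rule needs one time bound for all passes, and the code of each single number is at most
-- the total length, hence at most `B`.
does-numbers : ∀ ks {B z n q i m v r w s t h} → length ks ≡ n → length (concatMap encodeℕ ks) ≤ B →
  Does (for 3 1 (readNumber ⨾ block (store 2 5 ∷ const 0 1 ∷ add 2 0 2 ∷ [])))
       (5 + n * (3 + (3 + B * 12 + 3)))
       (reading z n (16 + q) i m v r w s t h (concatMap encodeℕ ks))
       (λ σ → ∃[ e ] ∃[ v ] Value n e 0 m v (write h q ks) [] σ)
does-numbers ks {B} {n = n} {q} {m = m} {h = h} refl ≤B =
  does-weaken ≤-refl finish
    (does-for Inv n refl (λ where (_ , _ , _ , _ , _ , _ , _ , _ , _ , _ , _ , _ , refl) → refl)
      (_ , q , _ , _ , _ , _ , _ , h , ks , refl , refl , ≤B , refl)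
      λ where
        _ _ (z , q , v , r , w , s , t , h , k ∷ todo , refl , eqh , ≤B , refl) →
          let ≤B′ = subst (_≤ B) (length-++ (encodeℕ k)) ≤B in
          does-⨾
            (does-weaken (+-monoʳ-≤ 3 (*-monoˡ-≤ 12 (≤-trans (m≤m+n (length (encodeℕ k)) _) ≤B′))) (λ q → q)
              (does-readNumber k))
            λ where
              (z , r , w , s , t , refl) →
                does-block (store 2 5 ∷ const 0 1 ∷ add 2 0 2 ∷ [])
                  (_ , suc q , k , _ , _ , _ , _ , _ , todo , refl , eqh ,
                   ≤-trans (m≤n+m _ (length (encodeℕ k))) ≤B′ , refl))
  where
  H = write h q ks
  Inv : ℕ → State → Set
  Inv j σ = ∃[ z ] ∃[ q′ ] ∃[ v ] ∃[ r ] ∃[ w ] ∃[ s ] ∃[ t ] ∃[ h′ ] ∃[ todo ]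
            length todo ≡ j × write h′ q′ todo ≡ H × length (concatMap encodeℕ todo) ≤ B ×
            σ ≡ reading z n (16 + q′) j m v r w s t h′ (concatMap encodeℕ todo)
  finish : ∀ {σ} → Inv 0 σ → _
  finish (z , q , v , r , w , s , t , h , [] , refl , eqh , _ , refl) =
    _ , v , z , r , w , s , t , cong (λ h → reading _ _ _ _ _ _ _ _ _ _ h _) eqh

-- Counting forks and clashes

sum< : ℕ → (ℕ → ℕ) → ℕ
sum< zero    f = 0
sum< (suc k) f = f k + sum< k f

diff : ℕ → ℕ → ℕ
diff a b = (a ∸ b) + (b ∸ a)

module _ (n : ℕ) (h : ℕ → ℕ) where

  -- The truncated subtractions encode conjunctions: fork x a b is nonzero iff a
  -- and b form a fork at x, and clash x y is nonzero iff x and y are distinct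
  -- forked vertices of the same colour.
  fork : ℕ → ℕ → ℕ → ℕ
  fork x a b = (h (x * n + a) + h (x * n + b)) ∸ (1 + ((1 ∸ diff a b) + h (a * n + b)))

  forks : ℕ → ℕ
  forks x = sum< n λ a → sum< n λ b → fork x a b

  clash : ℕ → ℕ → ℕ
  clash x y = 1 ∸ ((diff (h (n * n + x)) (h (n * n + y)) + (1 ∸ diff x y)) +
                   ((1 ∸ forks x) + (1 ∸ forks y)))

  clashes : ℕ
  clashes = sum< n λ x → sum< n λ y → clash x y

-- Registers: 2 address of the colours; 3, 5, 7, 9 the vertices x, y, a, b;
-- 4, 6, 8 addresses of the matrix rows of x, y, a; 10, 11 numbers of forks at
-- x and y; 12 number of clashes.
addForks : List Op
addForks =
  (sub 13 7 9 ∷ sub 14 9 7 ∷ add 13 13 14 ∷ const 0 1 ∷ sub 13 0 13 ∷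
   add 14 8 9 ∷ load 14 14 ∷ add 13 13 14 ∷ add 13 0 13 ∷
   add 14 4 7 ∷ load 14 14 ∷ add 15 4 9 ∷ load 15 15 ∷ add 14 14 15 ∷ sub 14 14 13 ∷ add 10 14 10 ∷
   add 14 6 7 ∷ load 14 14 ∷ add 15 6 9 ∷ load 15 15 ∷ add 14 14 15 ∷ sub 14 14 13 ∷ add 11 14 11 ∷
   [])

addClash : List Op
addClash =
  (add 13 2 3 ∷ load 13 13 ∷ add 14 2 5 ∷ load 14 14 ∷
   sub 15 13 14 ∷ sub 14 14 13 ∷ add 13 15 14 ∷
   sub 14 3 5 ∷ sub 15 5 3 ∷ add 14 14 15 ∷ const 0 1 ∷ sub 14 0 14 ∷ add 13 13 14 ∷
   sub 14 0 10 ∷ sub 15 0 11 ∷ add 14 14 15 ∷ add 13 13 14 ∷ sub 13 0 13 ∷ add 12 13 12 ∷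
   [])

-- One sweep over the pairs counts the forks at both `x` and `y`. Register 8 enters with the address
-- just past the matrix, which is that of the colours, and moves down one row for each `a`.
countForks : Cmd
countForks = for 7 1 (block (sub 8 8 1 ∷ []) ⨾ for 9 1 (block addForks))

enterPair : List Op
enterPair = sub 6 6 1 ∷ const 0 0 ∷ add 8 0 2 ∷ const 10 0 ∷ const 11 0 ∷ []

enterVertex : List Op
enterVertex = sub 4 4 1 ∷ const 0 0 ∷ add 6 0 2 ∷ []

countClashes : Cmd
countClashes =
  block (const 12 0 ∷ const 0 0 ∷ add 4 0 2 ∷ []) ⨾
  for 3 1 (block enterVertex ⨾ for 5 1 (block enterPair ⨾ countForks ⨾ block addClash))

add-first : ∀ t f r {u} → f + (t + r) ≡ u → t + f + r ≡ u
add-first t f r eq = trans (trans (cong (_+ r) (+-comm t f)) (+-assoc f t r)) eq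

-- For outer loops: the inner loop has raised the counter from `f` to `f′` by `t`, so `t` moves from
-- the remainder into the counter.
absorb : ∀ f f′ {t r u} → f + (t + r) ≡ u → f′ + 0 ≡ f + t → f′ + r ≡ u
absorb f f′ {t} {r} eq eq′ =
  trans (cong (_+ r) (trans (sym (+-identityʳ f′)) eq′)) (trans (+-assoc f t r) eq)

row-below : ∀ n q → 16 + (n + q) ∸ n ≡ 16 + q
row-below n q = trans (cong (_∸ n) (swap n q)) (m+n∸m≡n n (16 + q))
  where
  swap : ∀ n q → 16 + (n + q) ≡ n + (16 + q)
  swap n q = trans (sym (+-assoc 16 n q)) (trans (cong (_+ q) (+-comm 16 n)) (+-assoc n 16 q))

module _ {n : ℕ} {h : ℕ → ℕ} {inp : List Bool} where

  counting : (x px y py a pa b f g bad z t₁ t₂ t₃ : ℕ) → State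
  counting x px y py a pa b f g bad z t₁ t₂ t₃ =
    ⟨ z ∷ n ∷ 16 + n * n ∷ x ∷ px ∷ y ∷ py ∷ a ∷ pa ∷ b ∷ f ∷ g ∷ bad ∷ t₁ ∷ t₂ ∷ t₃ ∷ [] , h , inp ⟩

  module _ (x y bad : ℕ) where

    -- Each counter is paired with what is still to be added. As `sum<` peels off its largest index
    -- first, it follows the downward loops.
    CountingForks : (a pa b restf F restg G : ℕ) → State → Set
    CountingForks a pa b restf F restg G σ =
      ∃[ f ] ∃[ g ] f + restf ≡ F × g + restg ≡ G ×
      ∃[ z ] ∃[ t₁ ] ∃[ t₂ ] ∃[ t₃ ]
        σ ≡ counting x (16 + x * n) y (16 + y * n) a pa b f g bad z t₁ t₂ t₃

    -- True by computation: an address `16 + q` runs past the sixteen explicit registers and reaches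
    -- heap cell `q`.
    addForks-effect : ∀ {a b f g z t₁ t₂ t₃} →
      let T = 1 + ((1 ∸ diff a b) + h (a * n + b))
          U = h (y * n + a) + h (y * n + b) in
      applyAll addForks
        (counting x (16 + x * n) y (16 + y * n) a (16 + a * n) b f g bad z t₁ t₂ t₃) ≡
      counting x (16 + x * n) y (16 + y * n) a (16 + a * n) b (fork n h x a b + f) (fork n h y a b + g) bad
        1 T (U ∸ T) (h (y * n + b))
    addForks-effect = refl

    does-row : ∀ {a b f g z t₁ t₂ t₃} →
      Does (for 9 1 (block addForks)) (5 + n * (3 + 23))
        (counting x (16 + x * n) y (16 + y * n) a (16 + a * n) b f g bad z t₁ t₂ t₃)
        (CountingForks a (16 + a * n) 0
           0 (f + sum< n (fork n h x a)) 0 (g + sum< n (fork n h y a)))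
    does-row {a} {f = f} {g} = does-for
      (λ b → CountingForks a (16 + a * n) b
               (sum< b (fork n h x a)) (f + sum< n (fork n h x a))
               (sum< b (fork n h y a)) (g + sum< n (fork n h y a))) n refl
      (λ where (_ , _ , _ , _ , _ , _ , _ , _ , refl) → refl)
      (_ , _ , refl , refl , _ , _ , _ , _ , refl)
      λ where
        b _ (f , g , eqf , eqg , z , t₁ , t₂ , t₃ , refl) →
          does-to addForks _ (addForks-effect {a} {b} {f} {g} {z} {t₁} {t₂} {t₃})
            (_ , _ , add-first (fork n h x a b) f _ eqf , add-first (fork n h y a b) g _ eqg ,
             _ , _ , _ , _ , refl)

    does-countForks : ∀ {a b z t₁ t₂ t₃} →
      Does countForks (5 + n * (3 + (1 + (5 + n * (3 + 23)))))
        (counting x (16 + x * n) y (16 + y * n) a (16 + n * n) b 0 0 bad z t₁ t₂ t₃)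
        (λ σ → ∃[ a ] ∃[ pa ] ∃[ b ] ∃[ z ] ∃[ t₁ ] ∃[ t₂ ] ∃[ t₃ ]
           σ ≡ counting x (16 + x * n) y (16 + y * n) a pa b (forks n h x) (forks n h y) bad z t₁ t₂ t₃)
    does-countForks = does-weaken ≤-refl finish (does-for Inv n refl
      (λ where (_ , _ , _ , _ , _ , _ , _ , _ , _ , refl) → refl)
      (_ , _ , _ , refl , refl , _ , _ , _ , _ , refl)
      λ where
        a _ (b , f , g , eqf , eqg , z , t₁ , t₂ , t₃ , refl) →
          after (sub 8 8 1 ∷ [])
            (counting x (16 + x * n) y (16 + y * n) a (16 + a * n) b f g bad 1 t₁ t₂ t₃)
            (cong (λ pa → counting x (16 + x * n) y (16 + y * n) a pa b f g bad 1 t₁ t₂ t₃)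
                  (row-below n (a * n)))
            (does-weaken ≤-refl (next a f g eqf eqg) does-row))
      where
      Fx Fy : ℕ → ℕ
      Fx a = sum< n (fork n h x a)
      Fy a = sum< n (fork n h y a)
      Inv : ℕ → State → Set
      Inv a σ = ∃[ b ] CountingForks a (16 + a * n) b
                         (sum< a Fx) (forks n h x) (sum< a Fy) (forks n h y) σ
      next : ∀ a f g → f + sum< (suc a) Fx ≡ forks n h x → g + sum< (suc a) Fy ≡ forks n h y →
        ∀ {σ} → CountingForks a (16 + a * n) 0 0 (f + Fx a) 0 (g + Fy a) σ → Inv a σ
      next a f g eqf eqg (f′ , g′ , eqf′ , eqg′ , rest) =
        0 , f′ , g′ , absorb f f′ eqf eqf′ , absorb g g′ eqg eqg′ , rest
      finish : ∀ {σ} → Inv 0 σ → _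
      finish (b , f , g , eqf , eqg , z , t₁ , t₂ , t₃ , refl) =
        _ , _ , _ , _ , _ , _ , _ ,
        cong₂ (λ f g → counting x (16 + x * n) y (16 + y * n) 0 16 b f g bad z t₁ t₂ t₃)
          (trans (sym (+-identityʳ f)) eqf) (trans (sym (+-identityʳ g)) eqg)

    addClash-effect : ∀ {a pa b z t₁ t₂ t₃} →
      applyAll addClash
        (counting x (16 + x * n) y (16 + y * n) a pa b (forks n h x) (forks n h y) bad z t₁ t₂ t₃) ≡
      counting x (16 + x * n) y (16 + y * n) a pa b (forks n h x) (forks n h y) (clash n h x y + bad)
        1 (clash n h x y) ((1 ∸ forks n h x) + (1 ∸ forks n h y)) (1 ∸ forks n h y)
    addClash-effect = refl

  module _ (x bad₀ : ℕ) where

    CountingPairs : (y : ℕ) → State → Set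
    CountingPairs y σ =
      ∃[ bad ] bad + sum< y (clash n h x) ≡ bad₀ + sum< n (clash n h x) ×
      ∃[ a ] ∃[ pa ] ∃[ b ] ∃[ f ] ∃[ g ] ∃[ z ] ∃[ t₁ ] ∃[ t₂ ] ∃[ t₃ ]
        σ ≡ counting x (16 + x * n) y (16 + y * n) a pa b f g bad z t₁ t₂ t₃

    does-pairs : ∀ {y a pa b f g z t₁ t₂ t₃} →
      Does (for 5 1 (block enterPair ⨾ countForks ⨾ block addClash))
        (5 + n * (3 + (5 + (5 + n * (3 + (1 + (5 + n * (3 + 23)))) + 19))))
        (counting x (16 + x * n) y (16 + n * n) a pa b f g bad₀ z t₁ t₂ t₃)
        (CountingPairs 0)
    does-pairs = does-for CountingPairs n refl
      (λ where (_ , _ , _ , _ , _ , _ , _ , _ , _ , _ , _ , refl) → refl)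
      (_ , refl , _ , _ , _ , _ , _ , _ , _ , _ , _ , refl)
      λ where
        y _ (bad , eq , a , pa , b , f , g , z , t₁ , t₂ , t₃ , refl) →
          after enterPair (counting x (16 + x * n) y (16 + y * n) a (16 + n * n) b 0 0 bad 0 t₁ t₂ t₃)
            (cong (λ py → counting x (16 + x * n) y py a (16 + n * n) b 0 0 bad 0 t₁ t₂ t₃)
                  (row-below n (y * n)))
            (does-⨾ (does-countForks x y bad) λ where
              (a , pa , b , z , t₁ , t₂ , t₃ , refl) →
                does-to addClash _ (addClash-effect x y bad {a} {pa} {b} {z} {t₁} {t₂} {t₃})
                  (_ , add-first (clash n h x y) bad _ eq , _ , _ , _ , _ , _ , _ , _ , _ , _ , refl))

  Counting : (x : ℕ) → State → Set
  Counting x σ =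
    ∃[ bad ] bad + sum< x (λ x → sum< n (clash n h x)) ≡ clashes n h ×
    ∃[ y ] ∃[ py ] ∃[ a ] ∃[ pa ] ∃[ b ] ∃[ f ] ∃[ g ] ∃[ z ] ∃[ t₁ ] ∃[ t₂ ] ∃[ t₃ ]
      σ ≡ counting x (16 + x * n) y py a pa b f g bad z t₁ t₂ t₃

  does-countClashes : ∀ {x px y py a pa b f g bad z t₁ t₂ t₃} →
    Does countClashes
      (3 + (5 + n * (3 + (3 +
        (5 + n * (3 + (5 + (5 + n * (3 + (1 + (5 + n * (3 + 23)))) + 19))))))))
      (counting x px y py a pa b f g bad z t₁ t₂ t₃)
      (λ σ → σ ! 12 ≡ clashes n h)
  does-countClashes {x} {px} {y} {py} {a} {pa} {b} {f} {g} {bad} {z} {t₁} {t₂} {t₃} =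
    after _ (counting x (16 + n * n) y py a pa b f g 0 0 t₁ t₂ t₃) refl
    (does-weaken ≤-refl (λ where
        (bad , eq , _ , _ , _ , _ , _ , _ , _ , _ , _ , _ , _ , refl) → trans (sym (+-identityʳ bad)) eq)
      (does-for Counting n refl
        (λ where (_ , _ , _ , _ , _ , _ , _ , _ , _ , _ , _ , _ , _ , refl) → refl)
        (_ , refl , _ , _ , _ , _ , _ , _ , _ , _ , _ , _ , _ , refl)
        λ where
          x _ (bad , eq , y , py , a , pa , b , f , g , z , t₁ , t₂ , t₃ , refl) →
            after enterVertex
              (counting x (16 + x * n) y (16 + n * n) a pa b f g bad 0 t₁ t₂ t₃)
              (cong (λ px → counting x px y (16 + n * n) a pa b f g bad 0 t₁ t₂ t₃)
                    (row-below n (x * n)))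
              (does-weaken ≤-refl (λ where
                  (bad′ , eq′ , a , pa , b , f , g , z , t₁ , t₂ , t₃ , refl) →
                    bad′ , absorb bad bad′ eq eq′ , _ , _ , a , pa , b , f , g , z , t₁ , t₂ , t₃ , refl)
                (does-pairs x bad))))

write-++ : ∀ {h q} vs {ws} → write h q (vs ++ ws) ≡ write (write h q vs) (q + length vs) ws
write-++ {h} {q} []       {ws} = cong (λ q → write h q ws) (sym (+-identityʳ q))
write-++ {h} {q} (v ∷ vs) {ws} =
  trans (write-++ vs)
        (cong (λ p → write (write h q (v ∷ vs)) p ws) (sym (+-suc q (length vs))))

-- The complete program

decide : Cmd
decide =
  readNumber ⨾
  block (const 0 0 ∷ add 1 0 5 ∷ []) ⨾
  for 3 1 (block (add 4 4 1 ∷ [])) ⨾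
  block (const 2 16 ∷ []) ⨾
  for 3 4 (block (read 6 ∷ store 2 6 ∷ const 0 1 ∷ add 2 0 2 ∷ [])) ⨾
  for 3 1 (readNumber ⨾ block (store 2 5 ∷ const 0 1 ∷ add 2 0 2 ∷ [])) ⨾
  block (const 2 16 ∷ add 2 2 4 ∷ []) ⨾
  countClashes

does-decide : ∀ n bs ks {B} → length bs ≡ n * n → length ks ≡ n → length (concatMap encodeℕ ks) ≤ B →
  Does decide
    ((3 + length (encodeℕ n) * 12) + (2 + ((5 + n * (3 + 1)) + (1 + ((5 + length bs * (3 + 4)) +
     ((5 + n * (3 + (3 + B * 12 + 3))) + (2 +
     (3 + (5 + n * (3 + (3 +
        (5 + n * (3 + (5 + (5 + n * (3 + (1 + (5 + n * (3 + 23)))) + 19)))))))))))))))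
    (start 16 (encodeℕ n ++ bs ++ concatMap encodeℕ ks))
    (λ σ → σ ! 12 ≡ clashes n (write (λ _ → 0) 0 (map bit bs ++ ks)))
does-decide n bs ks {B} len-bs len-ks ≤B =
  does-⨾ (does-readNumber n) λ where
   (z , r , w , s , t , refl) →
    after _ (reading 0 n 0 0 0 n r w s t (λ _ → 0) (bs ++ concatMap encodeℕ ks)) refl
     (does-⨾ does-square λ where
      (z , refl) →
       after _ (reading z n 16 0 (length bs) n r w s t (λ _ → 0) (bs ++ concatMap encodeℕ ks))
         -- Register 4 holds `n * n`, which `does-bits` expects in the form `length bs`.
         (cong (λ m → reading z n 16 0 m n r w s t (λ _ → 0) (bs ++ concatMap encodeℕ ks)) (sym len-bs))
       (does-⨾ (does-bits bs) λ where
        (z , r , refl) →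
         does-⨾ (does-numbers ks len-ks ≤B) λ where
          (e , v , z , r , w , s , t , refl) →
           after _ (reading z n (16 + n * n) 0 (n * n) v r w s t
                     (write (λ _ → 0) 0 (map bit bs ++ ks)) [])
             (cong₂ (λ m h → reading z n (16 + m) 0 m v r w s t h []) len-bs
               (sym (trans (write-++ (map bit bs))
                          (cong (λ l → write (write (λ _ → 0) 0 (map bit bs)) l ks) (length-map bit bs)))))
             does-countClashes))

-- Polynomial running time

module _ {L : ℕ} (1≤L : 1 ≤ L) where

  private
    instance
      L≢0 : NonZero L
      L≢0 = >-nonZero 1≤L

  infix 4 _⊑_·L^_
  record _⊑_·L^_ (t c k : ℕ) : Set where
    constructor bounded
    field
      bound : t ≤ c * L ^ k

  open _⊑_·L^_ public

  ⊑-const : ∀ c k → c ⊑ c ·L^ k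
  ⊑-const c k = bounded (m≤m*n c (L ^ k) {{m^n≢0 L k}})

  ⊑-+ : ∀ k {t t′ c c′} → t ⊑ c ·L^ k → t′ ⊑ c′ ·L^ k → t + t′ ⊑ c + c′ ·L^ k
  ⊑-+ k {c = c} {c′} (bounded p) (bounded q) =
    bounded (≤-trans (+-mono-≤ p q) (≤-reflexive (sym (*-distribʳ-+ (L ^ k) c c′))))

  ⊑-* : ∀ k {n t c} → n ≤ L → t ⊑ c ·L^ k → n * t ⊑ c ·L^ suc k
  ⊑-* k {c = c} p (bounded q) = bounded (≤-trans (*-mono-≤ p q) (≤-reflexive (swap c L (L ^ k))))
    where
    swap : ∀ c l m → l * (c * m) ≡ c * (l * m)
    swap c l m = trans (sym (*-assoc l c m)) (trans (cong (_* m) (*-comm l c)) (*-assoc c l m))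

  ⊑-raise : ∀ {j k t c} → j ≤ k → t ⊑ c ·L^ j → t ⊑ c ·L^ k
  ⊑-raise {c = c} j≤k (bounded p) = bounded (≤-trans p (*-monoʳ-≤ c (^-monoʳ-≤ L j≤k)))

  -- A loop of at most `L` passes raises the degree by one.
  ⊑-for : ∀ k {n t c} → n ≤ L → t ⊑ c ·L^ k → 5 + n * (3 + t) ⊑ 5 + (3 + c) ·L^ suc k
  ⊑-for k n≤L p = ⊑-+ (suc k) (⊑-const 5 (suc k)) (⊑-* k n≤L (⊑-+ k (⊑-const 3 k) p))

  -- The degree 4 comes from the four nested loops over vertices; 153 is the sum of the coefficients
  -- of all phases, lower powers of `L` being raised to the fourth.
  decide-time : ∀ {n m ℓ} → n ≤ L → m ≤ L → ℓ ≤ L →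
    (3 + ℓ * 12) + (2 + ((5 + n * (3 + 1)) + (1 + ((5 + m * (3 + 4)) +
      ((5 + n * (3 + (3 + L * 12 + 3))) + (2 +
      (3 + (5 + n * (3 + (3 +
        (5 + n * (3 + (5 + (5 + n * (3 + (1 + (5 + n * (3 + 23)))) + 19))))))))))))))
    ⊑ 153 ·L^ 4
  decide-time n≤L m≤L ℓ≤L =
    (num 3 ⊞ ⊑-raise (m≤m+n 1 3) (⊑-* 0 ℓ≤L (⊑-const 12 0))) ⊞
    num 2 ⊞ ⊑-raise (m≤m+n 1 3) (⊑-for 0 n≤L (⊑-const 1 0)) ⊞
    num 1 ⊞ ⊑-raise (m≤m+n 1 3) (⊑-for 0 m≤L (⊑-const 4 0)) ⊞
    ⊑-raise (m≤m+n 2 2) (⊑-for 1 n≤L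
      (⊑-+ 1 (⊑-+ 1 (⊑-const 3 1) (⊑-* 0 ≤-refl (⊑-const 12 0))) (⊑-const 3 1))) ⊞
    num 2 ⊞ num 3 ⊞
    ⊑-for 3 n≤L (⊑-+ 3 (⊑-const 3 3)
      (⊑-for 2 n≤L (⊑-+ 2 (⊑-const 5 2)
        (⊑-+ 2 (⊑-for 1 n≤L (⊑-+ 1 (⊑-const 1 1) (⊑-for 0 n≤L (⊑-const 23 0))))
               (⊑-const 19 2)))))
    where
    num : ∀ c → c ⊑ c ·L^ 4
    num c = ⊑-const c 4
    infixr 5 _⊞_
    _⊞_ : ∀ {t t′ c c′} → t ⊑ c ·L^ 4 → t′ ⊑ c′ ·L^ 4 → t + t′ ⊑ c + c′ ·L^ 4
    _⊞_ = ⊑-+ 4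

decideProgram : Program
decideProgram = decider decide 12

outcome-decide : ∀ n bs ks L → length bs ≡ n * n → length ks ≡ n → length (concatMap encodeℕ ks) ≤ L →
  1 ≤ L → n ≤ L → n * n ≤ L → length (encodeℕ n) ≤ L →
  outcome decideProgram (encodeℕ n ++ bs ++ concatMap encodeℕ ks) (155 * L ^ 4 + 155) ≡
  just (clashes n (write (λ _ → 0) 0 (map bit bs ++ ks)) ≡ᵇ 0)
outcome-decide n bs ks L len-bs len-ks ks≤ 1≤L n≤ n²≤ code≤ =
  outcome-decider 16 {decide} {12} {u = 155 * L ^ 4 + 155}
    {v = clashes n (write (λ _ → 0) 0 (map bit bs ++ ks))}
    (does-decide n bs ks len-bs len-ks ks≤)
    -- The closing jump and `halt` cost two more steps, which the additive constant absorbs.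
    (slack (L ^ 4) (bound (decide-time 1≤L n≤ (subst (_≤ L) (sym len-bs) n²≤) code≤)))
  where
  slack : ∀ {t} x → t ≤ 153 * x → 2 + t ≤ 155 * x + 155
  slack x t≤ =
    ≤-trans (+-mono-≤ (m≤m+n 2 153) (≤-trans t≤ (*-monoˡ-≤ x (m≤m+n 153 2))))
            (≤-reflexive (+-comm 155 (155 * x)))

-- Correctness of the count of clashes

write-below : ∀ {h q} vs {a} → a < q → write h q vs a ≡ h a
write-below         []       a<q = refl
write-below {h} {q} (v ∷ vs) {a} a<q = trans (write-below vs (m<n⇒m<1+n a<q)) (skip (a ≡ᵇ q) refl)
  where
  skip : ∀ b → (a ≡ᵇ q) ≡ b → (if b then v else h a) ≡ h a
  skip false _  = refl
  skip true  eq = ⊥-elim (<⇒≢ a<q (≡ᵇ⇒≡ a q (subst T (sym eq) _)))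

-- Lookup as a relation with a natural index, so that positions in concatenated lists are plain
-- sums, as in the machine's addresses.
data _[_]=_ {A : Set} : List A → ℕ → A → Set where
  here  : ∀ {x xs} → (x ∷ xs) [ 0 ]= x
  there : ∀ {x y xs i} → xs [ i ]= x → (y ∷ xs) [ suc i ]= x

module _ {A : Set} where

  []=-++ˡ : ∀ {xs ys : List A} {i x} → xs [ i ]= x → (xs ++ ys) [ i ]= x
  []=-++ˡ here      = here
  []=-++ˡ (there p) = there ([]=-++ˡ p)

  []=-++ʳ : ∀ xs {ys : List A} {i x} → ys [ i ]= x → (xs ++ ys) [ length xs + i ]= x
  []=-++ʳ []       p = p
  []=-++ʳ (_ ∷ xs) p = there ([]=-++ʳ xs p)

  []=-map : ∀ {B : Set} (f : A → B) {xs i x} → xs [ i ]= x → map f xs [ i ]= f x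
  []=-map f here      = here
  []=-map f (there p) = there ([]=-map f p)

  []=-tabulate : ∀ {n} (f : Fin n → A) u → tabulate f [ toℕ u ]= f u
  []=-tabulate f zero    = here
  []=-tabulate f (suc u) = there ([]=-tabulate (f ∘ suc) u)

  -- Row-major addressing: `i` full rows of length `n` precede the row `xs`.
  []=-concat : ∀ {n} {xss : List (List A)} {i xs j x} → All (λ xs → length xs ≡ n) xss →
    xss [ i ]= xs → xs [ j ]= x → concat xss [ i * n + j ]= x
  []=-concat             _          here      q = []=-++ˡ q
  []=-concat {xss = ys ∷ yss} {suc i} {j = j} {x} (refl ∷ ls) (there p) q =
    subst (concat (ys ∷ yss) [_]= x) (sym (+-assoc (length ys) (i * length ys) j))
      ([]=-++ʳ ys ([]=-concat {xss = yss} ls p q))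

  length-concat : ∀ {n} {xss : List (List A)} → All (λ xs → length xs ≡ n) xss →
    length (concat xss) ≡ length xss * n
  length-concat []                         = refl
  length-concat {xss = xs ∷ _} (refl ∷ ls) = trans (length-++ xs) (cong (length xs +_) (length-concat ls))

[]=-allFin : ∀ {n} {A : Set} (f : Fin n → A) u → map f (allFin n) [ toℕ u ]= f u
[]=-allFin f u = []=-map f ([]=-tabulate id u)

write-[]= : ∀ {h q vs i v} → vs [ i ]= v → write h q vs (q + i) ≡ v
write-[]= {h} {q} {v ∷ vs} here =
  trans (cong (write h q (v ∷ vs)) (+-identityʳ q))
    (trans (write-below vs (n<1+n q)) (cong (if_then v else h q) (Equivalence.to T-≡ (≡⇒≡ᵇ q q refl))))
write-[]= {h} {q} {w ∷ vs} {suc i} (there p) =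
  trans (cong (write h q (w ∷ vs)) (+-suc q i)) (write-[]= p)

-- Arithmetic as logic

diff≡0⇔≡ : ∀ {a b} → diff a b ≡ 0 ⇔ a ≡ b
diff≡0⇔≡ {a} {b} = mk⇔
  (λ eq → ≤-antisym (m∸n≡0⇒m≤n (m+n≡0⇒m≡0 (a ∸ b) eq)) (m∸n≡0⇒m≤n (m+n≡0⇒n≡0 (a ∸ b) eq)))
  (λ where refl → cong₂ _+_ (n∸n≡0 a) (n∸n≡0 a))

-- With nonzero standing for truth, `1 ∸ m` is negation.
1∸m≡0⇔m≢0 : ∀ {m} → 1 ∸ m ≡ 0 ⇔ m ≢ 0
1∸m≡0⇔m≢0 {zero}  = mk⇔ (λ ()) (λ m≢0 → ⊥-elim (m≢0 refl))
1∸m≡0⇔m≢0 {suc m} = mk⇔ (λ _ ()) (λ _ → 0∸n≡0 m)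

1∸m≢0⇔m≡0 : ∀ {m} → 1 ∸ m ≢ 0 ⇔ m ≡ 0
1∸m≢0⇔m≡0 {zero}  = mk⇔ (λ _ → refl) (λ _ ())
1∸m≢0⇔m≡0 {suc m} = mk⇔ (λ ≢0 → ⊥-elim (≢0 (0∸n≡0 m))) (λ ())

-- With nonzero standing for truth, a sum is an existential quantifier over the vertices.
sum≢0⇔ : ∀ {n f} → sum< n f ≢ 0 ⇔ (∃[ u ] f (toℕ {n} u) ≢ 0)
sum≢0⇔ {n} {f} = mk⇔
  (λ ≢0 → let i , i<n , fi≢0 = witness n ≢0 in
          fromℕ< i<n , subst (λ i → f i ≢ 0) (sym (toℕ-fromℕ< i<n)) fi≢0)
  (λ (u , fu≢0) → positive n (toℕ<n u) fu≢0)
  where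
  witness : ∀ k → sum< k f ≢ 0 → ∃[ i ] i < k × f i ≢ 0
  witness zero    ≢0 = ⊥-elim (≢0 refl)
  witness (suc k) ≢0 with f k ≟ 0
  ... | no fk≢0  = k , n<1+n k , fk≢0
  ... | yes fk≡0 with i , i<k , fi≢0 ← witness k (λ eq → ≢0 (cong₂ _+_ fk≡0 eq)) =
    i , m<n⇒m<1+n i<k , fi≢0
  positive : ∀ k {i} → i < k → f i ≢ 0 → sum< k f ≢ 0
  positive (suc k) {i} i<1+k fi≢0 eq with i ≟ k
  ... | yes refl = fi≢0 (m+n≡0⇒m≡0 (f k) eq)
  ... | no i≢k   = positive k (≤∧≢⇒< (s≤s⁻¹ i<1+k) i≢k) fi≢0 (m+n≡0⇒n≡0 (f k) eq)

-- The minuend is at most 2 and the subtrahend at least 1, so the difference is nonzero only for the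
-- values 2 and 1.
fork-value : ∀ p q m e →
  (bit p + bit q) ∸ (1 + (e + bit m)) ≢ 0 ⇔ (T p × T q × e ≡ 0 × ¬ T m)
fork-value p q m e = mk⇔ (to p q m e ∘ m∸n≢0⇒n<m) (from p q m e)
  where
  to : ∀ p q m e → 1 + (e + bit m) < bit p + bit q → T p × T q × e ≡ 0 × ¬ T m
  to true true  false zero    _             = _ , _ , refl , λ ()
  to true true  true  zero    (s≤s (s≤s ()))
  to true true  _     (suc _) (s≤s (s≤s ()))
  to true false _     _       (s≤s ())
  to false true _     _       (s≤s ())
  from : ∀ p q m e → T p × T q × e ≡ 0 × ¬ T m → (bit p + bit q) ∸ (1 + (e + bit m)) ≢ 0
  from true true false zero _ ()
  from true true true  _    (_ , _ , _ , ¬m) = ⊥-elim (¬m _)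

module _ {n : ℕ} (G : Graph n) (ψ : Fin n → ℕ) (h : ℕ → ℕ)
         (matrix  : ∀ u v → h (toℕ u * n + toℕ v) ≡ bit (adj G u v))
         (colours : ∀ u → h (n * n + toℕ u) ≡ ψ u) where

  open Equivalence

  fork≢0⇔ : ∀ x a b → fork n h (toℕ x) (toℕ a) (toℕ b) ≢ 0 ⇔ Fork G x a b
  fork≢0⇔ x a b rewrite matrix x a | matrix x b | matrix a b = mk⇔
    (λ ≢0 → let xa , xb , e , ¬ab = to (fork-value _ _ _ _) ≢0 in
            xa , xb , (λ eq → to 1∸m≡0⇔m≢0 e (from diff≡0⇔≡ (cong toℕ eq))) , ¬ab)
    (λ (xa , xb , a≢b , ¬ab) → from (fork-value _ _ _ _)
       (xa , xb , from 1∸m≡0⇔m≢0 (λ eq → a≢b (toℕ-injective (to diff≡0⇔≡ eq))) , ¬ab))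

  forks≢0⇔ : ∀ x → forks n h (toℕ x) ≢ 0 ⇔ Forked G x
  forks≢0⇔ x = mk⇔
    (λ ≢0 → let a , ≢0′ = to sum≢0⇔ ≢0 ; b , ≢0″ = to sum≢0⇔ ≢0′ in a , b , to (fork≢0⇔ x a b) ≢0″)
    (λ (a , b , f) → from sum≢0⇔ (a , from sum≢0⇔ (b , from (fork≢0⇔ x a b) f)))

  clash≢0⇔ : ∀ x y → clash n h (toℕ x) (toℕ y) ≢ 0 ⇔ (x ≢ y × ψ x ≡ ψ y × Forked G x × Forked G y)
  clash≢0⇔ x y rewrite colours x | colours y = mk⇔
    (λ ≢0 →
      let all      = to 1∸m≢0⇔m≡0 ≢0
          colour,e = m+n≡0⇒m≡0 (diff (ψ x) (ψ y) + (1 ∸ diff (toℕ x) (toℕ y))) all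
          forkless = m+n≡0⇒n≡0 (diff (ψ x) (ψ y) + (1 ∸ diff (toℕ x) (toℕ y))) all
          e        = m+n≡0⇒n≡0 (diff (ψ x) (ψ y)) colour,e
      in (λ x≡y → to 1∸m≡0⇔m≢0 e (from diff≡0⇔≡ (cong toℕ x≡y))) ,
         to diff≡0⇔≡ (m+n≡0⇒m≡0 (diff (ψ x) (ψ y)) colour,e) ,
         to (forks≢0⇔ x) (to 1∸m≡0⇔m≢0 (m+n≡0⇒m≡0 _ forkless)) ,
         to (forks≢0⇔ y) (to 1∸m≡0⇔m≢0 (m+n≡0⇒n≡0 (1 ∸ forks n h (toℕ x)) forkless)))
    (λ (x≢y , ψx≡ψy , fx , fy) → from 1∸m≢0⇔m≡0
      (cong₂ _+_
        (cong₂ _+_ (from diff≡0⇔≡ ψx≡ψy) (from 1∸m≡0⇔m≢0 (x≢y ∘ toℕ-injective ∘ to diff≡0⇔≡)))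
        (cong₂ _+_ (from 1∸m≡0⇔m≢0 (from (forks≢0⇔ x) fx)) (from 1∸m≡0⇔m≢0 (from (forks≢0⇔ y) fy)))))

  clashes≢0⇔ : clashes n h ≢ 0 ⇔ Clash G ψ
  clashes≢0⇔ = mk⇔
    (λ ≢0 → let x , ≢0′ = to sum≢0⇔ ≢0 ; y , ≢0″ = to sum≢0⇔ ≢0′ in x , y , to (clash≢0⇔ x y) ≢0″)
    (λ (x , y , c) → from sum≢0⇔ (x , from sum≢0⇔ (y , from (clash≢0⇔ x y) c)))

-- Instances and the size of their encodings

module _ (I : Instance) where

  open Instance I
  private
    n = order

  bits : List Bool
  bits = concatMap (λ u → map (adj graph u) (allFin n)) (allFin n)

  colourList : List ℕ
  colourList = map colour (allFin n)

  memoryOf : ℕ → ℕ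
  memoryOf = write (λ _ → 0) 0 (map bit bits ++ colourList)

  length-allFin : ∀ {A : Set} (f : Fin n → A) → length (map f (allFin n)) ≡ n
  length-allFin f = trans (length-map f (allFin n)) (length-tabulate {n = n} id)

  rows-length : All (λ row → length row ≡ n) (map (λ u → map (adj graph u) (allFin n)) (allFin n))
  rows-length = All.map⁺ (All.universal (λ u → length-allFin (adj graph u)) (allFin n))

  length-bits : length bits ≡ n * n
  length-bits = trans (length-concat rows-length) (cong (_* n) (length-allFin _))

  memoryOf-matrix : ∀ u v → memoryOf (toℕ u * n + toℕ v) ≡ bit (adj graph u v)
  memoryOf-matrix u v = write-[]= ([]=-++ˡ ([]=-map bit
    ([]=-concat rows-length ([]=-allFin _ u) ([]=-allFin (adj graph u) v))))

  memoryOf-colours : ∀ u → memoryOf (n * n + toℕ u) ≡ colour u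
  memoryOf-colours u = write-[]= (subst (λ l → (map bit bits ++ colourList) [ l + toℕ u ]= colour u)
    (trans (length-map bit bits) length-bits) ([]=-++ʳ (map bit bits) ([]=-allFin colour u)))

  colourCode : List Bool
  colourCode = concatMap encodeℕ colourList

  encode≡ : encode I ≡ encodeℕ n ++ bits ++ colourCode
  encode≡ = cong (λ l → encodeℕ n ++ bits ++ concat l) (map-∘ (allFin n))

  size : ℕ
  size = length (encode I)

  size≡ : size ≡ length (encodeℕ n) + (n * n + length colourCode)
  size≡ = trans (cong length encode≡)
    (trans (length-++ (encodeℕ n)) (cong (length (encodeℕ n) +_)
      (trans (length-++ bits) (cong (_+ length colourCode) length-bits))))

  order-code≤ : length (encodeℕ n) ≤ size
  order-code≤ = subst (length (encodeℕ n) ≤_) (sym size≡) (m≤m+n _ _)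

  square≤ : n * n ≤ size
  square≤ = subst (n * n ≤_) (sym size≡) (≤-trans (m≤m+n _ _) (m≤n+m _ (length (encodeℕ n))))

  colour-code≤ : length colourCode ≤ size
  colour-code≤ = subst (length colourCode ≤_) (sym size≡)
    (≤-trans (m≤n+m _ (n * n)) (m≤n+m _ (length (encodeℕ n))))

  -- The adjacency matrix makes the input at least `n * n` bits long, whereas the code of the order
  -- alone has only logarithmic length.
  order≤ : n ≤ size
  order≤ = ≤-trans (n≤n*n n) square≤
    where
    n≤n*n : ∀ n → n ≤ n * n
    n≤n*n zero    = z≤n
    n≤n*n (suc n) = m≤m*n (suc n) (suc n)

  1≤size : 1 ≤ size
  1≤size = ≤-trans (code≥1 (fromℕ n)) order-code≤
    where
    code≥1 : ∀ b → 1 ≤ length (encodeℕᵇ b)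
    code≥1 zeroᵇ    = s≤s z≤n
    code≥1 2[1+ _ ] = s≤s z≤n
    code≥1 1+[2 _ ] = s≤s z≤n

  outcome-encode : outcome decideProgram (encode I) (155 * size ^ 4 + 155) ≡
                   just (clashes n memoryOf ≡ᵇ 0)
  outcome-encode = trans (cong (λ inp → outcome decideProgram inp (155 * size ^ 4 + 155)) encode≡)
    (outcome-decide n bits colourList size length-bits (length-allFin colour)
      colour-code≤ 1≤size order≤ square≤ order-code≤)

corollary12 : SolvableInPolynomialTime encode
    (λ I → IsBlockGraph (Instance.graph I))
    (λ I → StronglyRainbowVertexConnected (Instance.graph I) (Instance.colour I))
corollary12 = decideProgram , 155 , 4 , λ I blockGraph →
  let open Instance I
      equiv = clashes≢0⇔ graph colour (memoryOf I) (memoryOf-matrix I) (memoryOf-colours I)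
      v     = clashes order (memoryOf I)
      answer = answered v
        (λ v≡0 → ¬clash⇒strong graph colour connected λ c → Equivalence.from equiv c v≡0)
        (λ v≢0 → clash⇒¬strong graph colour blockGraph (Equivalence.to equiv v≢0))
  in proj₁ answer , trans (outcome-encode I) (cong just (proj₂ answer))
  where
  -- Splitting on the count makes `does answer` compute to the Boolean that the program returns.
  answered : ∀ {Yes : Set} v → (v ≡ 0 → Yes) → (v ≢ 0 → ¬ Yes) →
    Σ[ answer ∈ Dec Yes ] (v ≡ᵇ 0) ≡ does answer
  answered zero    yes! no! = yes (yes! refl) , refl
  answered (suc _) yes! no! = no (no! λ ()) , refl
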